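{- Let $r\ge 2$ be an integer and let $\delta,\epsilon$ be real numbers with $0<\delta<1$, $\epsilon>0$ and $\epsilon<\delta/(16r-16)$. There is a constant $M(\epsilon)$ depending only on $\epsilon$ such that for all sufficiently large $n$ there is a graph $G$ on $n$ vertices with the following property: if fewer than $\frac{n^2}{4(r-1)}(1-3\delta)(1-\epsilon)^2$ edge-deletions and edge-additions are performed on $G$, then the resulting graph contains an $(\epsilon,r,L,\delta)$-configuration with $L\ge n(1-\epsilon)/M(\epsilon)$.
   Context: For a graph and disjoint vertex sets $A,B$, the density is $d(A,B)=e(A,B)/(|A||B|)$, where $e(A,B)$ is the number of edges with one endpoint in $A$ and the other in $B$. A pair $(A,B)$ is $\epsilon$-regular if for all $X\subseteq A$, $Y\subseteq B$ with $|X|>\epsilon|A|$, $|Y|>\epsilon|B|$ we have $|d(X,Y)-d(A,B)|<\epsilon$. An $(\epsilon,r,L,\delta)$-configuration in a graph consists of pairwise disjoint vertex sets $V_1,\dots,V_r$ with $|V_1|=\dots=|V_r|=L$ such that for all $1\le i<j\le r$ the pair $(V_i,V_j)$ is $\epsilon$-regular and $d(V_i,V_j)\in(\delta,1-\delta)$.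
   Formalization: The parameters δ and ε are taken to be rational numbers instead of real numbers. -}

module Defs where

open import Data.Nat as ℕ using (ℕ; zero; suc)
open import Data.Fin using (Fin; zero; suc; _<_)
open import Data.Fin.Properties using (_<?_)
open import Data.Bool using (Bool; true; false; if_then_else_; _∧_; _xor_)
open import Data.Vec using (lookup)
open import Data.Fin.Subset using (Subset; _∈_; _⊆_; ∣_∣)
open import Data.Integer using (+_)
open import Data.Rational as ℚ using (ℚ; _/_; 0ℚ)
open import Data.Product using (_×_)
open import Relation.Binary.PropositionalEquality using (_≡_)
open import Relation.Nullary using (¬_; ⌊_⌋)

record Graph (n : ℕ) : Set where
  field
    adj    : Fin n → Fin n → Bool
    sym    : ∀ u v → adj u v ≡ adj v u
    irrefl : ∀ u → adj u u ≡ false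
open Graph public

sumFin : ∀ {n} → (Fin n → ℕ) → ℕ
sumFin {zero}  f = 0
sumFin {suc n} f = f zero ℕ.+ sumFin (λ i → f (suc i))

ℕ→ℚ : ℕ → ℚ
ℕ→ℚ k = + k / 1

-- e(A,B): number of pairs (a,b) with a ∈ A, b ∈ B and ab an edge
-- (for disjoint A, B this is the number of edges between A and B).
e : ∀ {n} → Graph n → Subset n → Subset n → ℕ
e G A B = sumFin λ u → sumFin λ v →
  if lookup A u ∧ lookup B v ∧ adj G u v then 1 else 0

-- p / q as a rational, with the (never used) convention p / 0 = 0.
frac : ℕ → ℕ → ℚ
frac p zero    = 0ℚ
frac p (suc q) = + p / suc q

density : ∀ {n} → Graph n → Subset n → Subset n → ℚ
density G A B = frac (e G A B) (∣ A ∣ ℕ.* ∣ B ∣)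

Disjoint : ∀ {n} → Subset n → Subset n → Set
Disjoint A B = ∀ u → ¬ (u ∈ A × u ∈ B)

IsRegular : ∀ {n} → ℚ → Graph n → Subset n → Subset n → Set
IsRegular ε G A B = ∀ X Y → X ⊆ A → Y ⊆ B →
  ε ℚ.* ℕ→ℚ ∣ A ∣ ℚ.< ℕ→ℚ ∣ X ∣ →
  ε ℚ.* ℕ→ℚ ∣ B ∣ ℚ.< ℕ→ℚ ∣ Y ∣ →
  ℚ.∣ density G X Y ℚ.- density G A B ∣ ℚ.< ε

IsConfiguration : ∀ {n} → Graph n → ℚ → (r L : ℕ) → ℚ → (Fin r → Subset n) → Set
IsConfiguration G ε r L δ V =
  (∀ i j → ¬ (i ≡ j) → Disjoint (V i) (V j)) ×
  (∀ i → ∣ V i ∣ ≡ L) ×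
  (∀ i j → i < j →
     IsRegular ε G (V i) (V j) ×
     (δ ℚ.< density G (V i) (V j)) ×
     (density G (V i) (V j) ℚ.< 1ℚ' ℚ.- δ))
  where 1ℚ' = ℚ.1ℚ

HasConfiguration : ∀ {n} → Graph n → ℚ → (r L : ℕ) → ℚ → Set
HasConfiguration {n} G ε r L δ =
  Data.Product.Σ (Fin r → Subset n) (IsConfiguration G ε r L δ)
  where import Data.Product

-- Edit distance: number of unordered pairs {u,v} (u ≠ v) that are an edge in
-- exactly one of G, H (= minimal number of edge additions/deletions turning G into H).
editDist : ∀ {n} → Graph n → Graph n → ℕ
editDist G H = sumFin λ u → sumFin λ v →
  if ⌊ u <? v ⌋ ∧ (adj G u v xor adj H u v) then 1 else 0

{-# OPTIONS --safe #-}

-- G is the graph of the negative entries of a Sylvester–Hadamard matrix cut down to n rows and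
-- columns, so all its densities between large sets are within ε of 1/2.  Given H, start with k
-- disjoint sets of equal size filling almost all vertices, and give a tuple W₁, …, W_k of disjoint
-- sets of size L the potential
--   Φ(W) = ∑_{i≠j} (D(Wᵢ,Wⱼ) / L² − ε d_H(Wᵢ,Wⱼ)²),   D = number of edited pairs.
-- If some pair is irregular, cut every Wᵢ into q blocks of size L/q so that the irregularity is
-- witnessed by two of the blocks.  Averaged over all choices of one block from each Wᵢ, the edit
-- term is unchanged while the energy term increases, so some choice lowers q²Φ by ε³.  Since Φ is
-- bounded, after boundedly many steps all pairs are ε-regular and the sum of the edit densities
-- D / L² has grown by at most ε k².  If no r of the
-- sets form a configuration, then by Turán's theorem at least k²/(r−1) − k ordered pairs have
-- density in H outside (δ, 1−δ), each of them costing (1/2 − ε − δ) L² edits: too many.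

module Submission where

open import Defs hiding (sym)
open import Data.Bool using (Bool; true; false; if_then_else_; _∧_; _xor_; not)
open import Data.Empty using (⊥; ⊥-elim)
open import Data.Fin as Fin using (Fin; zero; suc; splitAt; _↑ˡ_; _↑ʳ_)
open import Data.Fin.Properties as Finₚ using (any?; splitAt-↑ˡ; splitAt-↑ʳ)
open import Data.Fin.Subset using (Subset; _∈_; _∉_; _⊆_; _─_; ⁅_⁆; Nonempty) renaming (∣_∣ to card; ⊥ to ∅; ⊤ to full; _-_ to _∖_)
open import Data.Fin.Subset.Properties using (nonempty?; drop-∷-⊆; p─q⊆p; ∣⁅x⁆∣≡1; x∈⁅y⁆⇒x≡y; ∈⊤; ⊆-trans; ∣⊥∣≡0; ∣⊤∣≡n; Empty-unique; anySubset?; _⊆?_)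
open import Data.Integer as ℤ using (+_; -[1+_]; +≤+; +<+)
import Data.Integer.Properties as ℤ
open import Data.Nat as ℕ using (ℕ; zero; suc; _∸_) renaming (_≤_ to _≤ℕ_; _<_ to _<ℕ_; _*_ to _*ℕ_)
open import Data.Nat.Coprimality as Coprime using (1-coprimeTo)
open import Data.Nat.DivMod using (m≡m%n+[m/n]*n; m%n<n; m≥n⇒m/n>0; m/n*n≤m)
import Data.Nat.Properties as ℕ
open import Data.Product using (Σ; _×_; _,_; proj₁; proj₂; ∃-syntax)
open import Data.Rational hiding (floor)
open import Data.Rational.Properties
open import Data.Rational.Solver using (module +-*-Solver)
open import Data.Rational.Unnormalised as ℚᵘ using (mkℚᵘ; *≡*)
import Data.Rational.Unnormalised.Properties as ℚᵘ
open import Data.Sum using (_⊎_; inj₁; inj₂; [_,_]′)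
open import Data.Unit using (tt)
open import Data.Vec using ([]; _∷_; here; there; lookup; tabulate)
open import Data.Vec.Properties using ([]=⇒lookup; lookup⇒[]=; lookup∘tabulate)
open import Function using (_∘_)
open import Relation.Binary.Definitions using (Tri; tri<; tri≈; tri>)
open import Relation.Binary.PropositionalEquality using (_≡_; refl; sym; trans; cong; cong₂; subst; subst₂)
open import Relation.Nullary using (¬_; Dec; yes; no; does; contradiction)
open import Relation.Nullary.Decidable using (⌊_⌋; isYes≗does; dec-true; dec-false; _×-dec_; ¬?)
open +-*-Solver using (solve; _:+_; _:*_; _:-_; :-_; _:=_; con)

-- Every pair has to be regular, not merely most pairs, so the proof descends to subsets; but edits
-- are few only on average, and subsets chosen for regularity alone might sit where `H` was edited
-- heavily. Subtracting ε times the energy from the edit density lets one averaging argument control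
-- both. The weight ε is positive, which bounds the number of steps, and so small that the whole
-- range of the energy term, at most ε k², is affordable. The number k of sets never changes, and r
-- enters only through Turán's theorem at the end; hence k, the number T of steps and M = k^(T+1)
-- depend on ε alone. For k the denominator of ε is taken, because k ε ≥ 1 is used throughout: a
-- subset of relative size above ε contains a block, Turán's loss k is at most ε k², and the fewer
-- than M uncovered vertices are at most ε n. With s = r - 1 and in units of k², the losses are s ε
-- (diagonal in Turán), 2 s ε (energy) and 2 ε (discrepancy of `G`), together at most 5 s ε < δ.

-- An opaque copy of ℕ→ℚ: unfolding the latter exposes the gcd computation of normalize.
opaque
  ⟦_⟧ : ℕ → ℚ
  ⟦ k ⟧ = ℕ→ℚ k

  ⟦⟧-def : ∀ k → ⟦ k ⟧ ≡ ℕ→ℚ k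
  ⟦⟧-def k = refl

  ⟦⟧-0 : ⟦ 0 ⟧ ≡ 0ℚ
  ⟦⟧-0 = refl

  ⟦⟧-1 : ⟦ 1 ⟧ ≡ 1ℚ
  ⟦⟧-1 = refl

  private
    ℕ→ℚ≡ : ∀ k → ℕ→ℚ k ≡ mkℚ (+ k) 0 (Coprime.sym (1-coprimeTo k))
    ℕ→ℚ≡ k = normalize-coprime (Coprime.sym (1-coprimeTo k))

  ⟦⟧-+ : ∀ a b → ⟦ a ℕ.+ b ⟧ ≡ ⟦ a ⟧ + ⟦ b ⟧
  ⟦⟧-+ a b = sym (trans (cong₂ _+_ (ℕ→ℚ≡ a) (ℕ→ℚ≡ b))
    (cong (_/ 1) (cong₂ ℤ._+_ (ℤ.*-identityʳ (+ a)) (ℤ.*-identityʳ (+ b)))))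

  ⟦⟧-* : ∀ a b → ⟦ a ℕ.* b ⟧ ≡ ⟦ a ⟧ * ⟦ b ⟧
  ⟦⟧-* a b = sym (trans (cong₂ _*_ (ℕ→ℚ≡ a) (ℕ→ℚ≡ b)) (cong (_/ 1) (sym (ℤ.pos-* a b))))

  ⟦⟧-≤ : ∀ {a b} → a ℕ.≤ b → ⟦ a ⟧ ≤ ⟦ b ⟧
  ⟦⟧-≤ {a} {b} a≤b = subst₂ _≤_ (sym (ℕ→ℚ≡ a)) (sym (ℕ→ℚ≡ b))
    (*≤* (ℤ.*-monoʳ-≤-nonNeg (+ 1) (+≤+ a≤b)))

  ⟦⟧-< : ∀ {a b} → a ℕ.< b → ⟦ a ⟧ < ⟦ b ⟧
  ⟦⟧-< {a} {b} a<b = subst₂ _<_ (sym (ℕ→ℚ≡ a)) (sym (ℕ→ℚ≡ b))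
    (*<* (ℤ.*-monoʳ-<-pos (+ 1) (+<+ a<b)))

⟦⟧-cancel-≤ : ∀ {a b} → ⟦ a ⟧ ≤ ⟦ b ⟧ → a ℕ.≤ b
⟦⟧-cancel-≤ {a} {b} p with a ℕ.≤? b
... | yes a≤b = a≤b
... | no a≰b = contradiction (<-≤-trans (⟦⟧-< (ℕ.≰⇒> a≰b)) p) (<-irrefl refl)

⟦⟧-nonneg : ∀ k → 0ℚ ≤ ⟦ k ⟧
⟦⟧-nonneg k = subst (_≤ ⟦ k ⟧) ⟦⟧-0 (⟦⟧-≤ {0} {k} ℕ.z≤n)

⟦⟧-suc : ∀ k → ⟦ suc k ⟧ ≡ 1ℚ + ⟦ k ⟧
⟦⟧-suc k = trans (⟦⟧-+ 1 k) (cong (_+ ⟦ k ⟧) ⟦⟧-1)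

-- Polynomial inequalities are proved by certificate: the nonnegative difference `d` is given
-- explicitly and the ring solver checks the identity.
≤-by : ∀ {p q} d → 0ℚ ≤ d → q ≡ p + d → p ≤ q
≤-by {p} d 0≤d refl = subst (_≤ p + d) (+-identityʳ p) (+-monoʳ-≤ p 0≤d)

≤-addʳ : ∀ p {d} → 0ℚ ≤ d → p ≤ p + d
≤-addʳ p {d} 0≤d = ≤-by d 0≤d refl

≤-addˡ : ∀ p {d} → 0ℚ ≤ d → p ≤ d + p
≤-addˡ p {d} 0≤d = ≤-by d 0≤d (+-comm d p)

≤⇒0≤- : ∀ {p q} → p ≤ q → 0ℚ ≤ q - p
≤⇒0≤- {p} {q} p≤q = subst (_≤ q - p) (+-inverseʳ p) (+-monoˡ-≤ (- p) p≤q)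

*-mono-≤ˡ : ∀ {r p q} → 0ℚ ≤ r → p ≤ q → r * p ≤ r * q
*-mono-≤ˡ {r} 0≤r = *-monoˡ-≤-nonNeg r {{nonNegative 0≤r}}

*-mono-≤ʳ : ∀ {r p q} → 0ℚ ≤ r → p ≤ q → p * r ≤ q * r
*-mono-≤ʳ {r} 0≤r = *-monoʳ-≤-nonNeg r {{nonNegative 0≤r}}

*-cancel-≤ˡ : ∀ {r p q} → 0ℚ < r → r * p ≤ r * q → p ≤ q
*-cancel-≤ˡ {r} 0<r = *-cancelˡ-≤-pos r {{positive 0<r}}

*-nonneg : ∀ {p q} → 0ℚ ≤ p → 0ℚ ≤ q → 0ℚ ≤ p * q
*-nonneg {p} 0≤p 0≤q = subst (_≤ p * _) (*-zeroʳ p) (*-mono-≤ˡ 0≤p 0≤q)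

*-pos : ∀ {p q} → 0ℚ < p → 0ℚ < q → 0ℚ < p * q
*-pos {p} {q} 0<p 0<q = positive⁻¹ (p * q) {{pos*pos⇒pos p {{positive 0<p}} q {{positive 0<q}}}}

+-nonneg : ∀ {p q} → 0ℚ ≤ p → 0ℚ ≤ q → 0ℚ ≤ p + q
+-nonneg = +-mono-≤

square-nonneg : ∀ p → 0ℚ ≤ p * p
square-nonneg p with ≤-total 0ℚ p
... | inj₁ 0≤p = *-nonneg 0≤p 0≤p
... | inj₂ p≤0 = subst (0ℚ ≤_) (solve 1 (λ p → (:- p) :* (:- p) := p :* p) refl p)
  (*-nonneg (neg-antimono-≤ p≤0) (neg-antimono-≤ p≤0))

square-mono : ∀ {p q} → 0ℚ ≤ p → p ≤ q → p * p ≤ q * q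
square-mono 0≤p p≤q = ≤-trans (*-mono-≤ˡ 0≤p p≤q) (*-mono-≤ʳ (≤-trans 0≤p p≤q) p≤q)

opaque
  unfolding ⟦_⟧

  -- Checked in the unnormalised rationals, where equality is cross multiplication and no gcd has to
  -- be computed.
  frac-* : ∀ p q → 0 ℕ.< q → frac p q * ⟦ q ⟧ ≡ ⟦ p ⟧
  frac-* p (suc q) _ = toℚᵘ-injective (begin-equality
    toℚᵘ (+ p / suc q * (+ suc q / 1))              ≃⟨ toℚᵘ-homo-* (+ p / suc q) (+ suc q / 1) ⟩
    toℚᵘ (+ p / suc q) ℚᵘ.* toℚᵘ (+ suc q / 1)      ≃⟨ ℚᵘ.*-cong (toℚᵘ-fromℚᵘ (mkℚᵘ (+ p) q)) (toℚᵘ-fromℚᵘ (mkℚᵘ (+ suc q) 0)) ⟩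
    mkℚᵘ (+ p) q ℚᵘ.* mkℚᵘ (+ suc q) 0              ≃⟨ *≡* (trans (ℤ.*-identityʳ _) (cong (λ k → + p ℤ.* + k) (sym (ℕ.*-identityʳ (suc q))))) ⟩
    mkℚᵘ (+ p) 0                                    ≃⟨ toℚᵘ-fromℚᵘ (mkℚᵘ (+ p) 0) ⟨
    toℚᵘ (+ p / 1)                                  ∎)
    where open ℚᵘ.≤-Reasoning

-- Finite sums of rationals

sum : ∀ {n} → (Fin n → ℚ) → ℚ
sum {zero} f = 0ℚ
sum {suc n} f = f zero + sum (f ∘ suc)

sum-cong : ∀ {n} {f g : Fin n → ℚ} → (∀ i → f i ≡ g i) → sum f ≡ sum g
sum-cong {zero} _ = refl
sum-cong {suc n} f≡g = cong₂ _+_ (f≡g zero) (sum-cong (f≡g ∘ suc))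

interchange : ∀ a b c d → a + b + (c + d) ≡ a + c + (b + d)
interchange = solve 4 (λ a b c d → a :+ b :+ (c :+ d) := a :+ c :+ (b :+ d)) refl

sum-+ : ∀ {n} (f g : Fin n → ℚ) → sum (λ i → f i + g i) ≡ sum f + sum g
sum-+ {zero} f g = refl
sum-+ {suc n} f g = trans (cong (_+_ (f zero + g zero)) (sum-+ (f ∘ suc) (g ∘ suc)))
  (interchange (f zero) (g zero) (sum (f ∘ suc)) (sum (g ∘ suc)))

sum-*ˡ : ∀ {n} x (f : Fin n → ℚ) → sum (λ i → x * f i) ≡ x * sum f
sum-*ˡ {zero} x f = sym (*-zeroʳ x)
sum-*ˡ {suc n} x f = trans (cong (_+_ (x * f zero)) (sum-*ˡ x (f ∘ suc))) (sym (*-distribˡ-+ x (f zero) (sum (f ∘ suc))))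

sum-*ʳ : ∀ {n} x (f : Fin n → ℚ) → sum (λ i → f i * x) ≡ sum f * x
sum-*ʳ x f = trans (sum-cong λ i → *-comm (f i) x) (trans (sum-*ˡ x f) (*-comm x (sum f)))

sum-const : ∀ n x → sum {n} (λ _ → x) ≡ ⟦ n ⟧ * x
sum-const zero x = sym (trans (cong (_* x) ⟦⟧-0) (*-zeroˡ x))
sum-const (suc n) x = trans (cong (_+_ x) (sum-const n x))
  (trans (solve 2 (λ n x → x :+ n :* x := (con 1ℚ :+ n) :* x) refl (⟦ n ⟧) x)
         (cong (_* x) (sym (⟦⟧-suc n))))

sum-comm : ∀ {m n} (f : Fin m → Fin n → ℚ) → sum (λ i → sum (f i)) ≡ sum (λ j → sum (λ i → f i j))
sum-comm {zero} {n} f = sym (trans (sum-const n 0ℚ) (*-zeroʳ (⟦ n ⟧)))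
sum-comm {suc m} f = trans (cong (_+_ (sum (f zero))) (sum-comm (f ∘ suc))) (sym (sum-+ (f zero) (λ j → sum (λ i → f (suc i) j))))

sum-mono : ∀ {n} {f g : Fin n → ℚ} → (∀ i → f i ≤ g i) → sum f ≤ sum g
sum-mono {zero} _ = ≤-refl
sum-mono {suc n} f≤g = +-mono-≤ (f≤g zero) (sum-mono (f≤g ∘ suc))

sum-nonneg : ∀ {n} {f : Fin n → ℚ} → (∀ i → 0ℚ ≤ f i) → 0ℚ ≤ sum f
sum-nonneg {zero} _ = ≤-refl
sum-nonneg {suc n} 0≤f = +-nonneg (0≤f zero) (sum-nonneg (0≤f ∘ suc))

term≤sum : ∀ {n} {f : Fin n → ℚ} → (∀ i → 0ℚ ≤ f i) → ∀ i → f i ≤ sum f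
term≤sum {f = f} 0≤f zero = ≤-addʳ (f zero) (sum-nonneg (0≤f ∘ suc))
term≤sum {f = f} 0≤f (suc i) = ≤-trans (term≤sum (0≤f ∘ suc) i) (≤-addˡ (sum (f ∘ suc)) (0≤f zero))

⟦⟧-sum : ∀ {n} (f : Fin n → ℕ) → ⟦ sumFin f ⟧ ≡ sum (λ i → ⟦ f i ⟧)
⟦⟧-sum {zero} f = ⟦⟧-0
⟦⟧-sum {suc n} f = trans (⟦⟧-+ (f zero) _) (cong (_+_ (⟦ f zero ⟧)) (⟦⟧-sum (f ∘ suc)))

-- Sums over subsets, and partitions into blocks of equal size

ind : Bool → ℚ
ind b = if b then 1ℚ else 0ℚ

ind-nonneg : ∀ b → 0ℚ ≤ ind b
ind-nonneg true = nonNegative⁻¹ 1ℚ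
ind-nonneg false = ≤-refl

ind≤1 : ∀ b → ind b ≤ 1ℚ
ind≤1 true = ≤-refl
ind≤1 false = nonNegative⁻¹ 1ℚ

χ : ∀ {n} → Subset n → Fin n → ℚ
χ A u = ind (lookup A u)

∑∈ : ∀ {n} → Subset n → (Fin n → ℚ) → ℚ
∑∈ A f = sum λ u → χ A u * f u

χ-∈ : ∀ {n} {A : Subset n} {u} → u ∈ A → χ A u ≡ 1ℚ
χ-∈ u∈A = cong ind ([]=⇒lookup u∈A)

χ-card : ∀ {n} (A : Subset n) → sum (χ A) ≡ ⟦ card A ⟧
χ-card [] = sym ⟦⟧-0
χ-card (true ∷ A) = trans (cong (_+_ 1ℚ) (χ-card A)) (sym (⟦⟧-suc (card A)))
χ-card (false ∷ A) = trans (+-identityˡ _) (χ-card A)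

∑∈-cong : ∀ {n} (A : Subset n) {f g : Fin n → ℚ} → (∀ u → f u ≡ g u) → ∑∈ A f ≡ ∑∈ A g
∑∈-cong A f≡g = sum-cong λ u → cong (χ A u *_) (f≡g u)

∑∈-mono : ∀ {n} (A : Subset n) {f g : Fin n → ℚ} → (∀ {u} → u ∈ A → f u ≤ g u) → ∑∈ A f ≤ ∑∈ A g
∑∈-mono A {f} {g} f≤g = sum-mono term
  where
  term : ∀ u → χ A u * f u ≤ χ A u * g u
  term u with lookup A u in eq
  ... | true = *-mono-≤ˡ (nonNegative⁻¹ 1ℚ) (f≤g (lookup⇒[]= u A eq))
  ... | false = ≤-reflexive (trans (*-zeroˡ (f u)) (sym (*-zeroˡ (g u))))

∑∈-const : ∀ {n} (A : Subset n) x → ∑∈ A (λ _ → x) ≡ ⟦ card A ⟧ * x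
∑∈-const A x = trans (sum-*ʳ x (χ A)) (cong (_* x) (χ-card A))

∑∈-nonneg : ∀ {n} (A : Subset n) {f : Fin n → ℚ} → (∀ {u} → u ∈ A → 0ℚ ≤ f u) → 0ℚ ≤ ∑∈ A f
∑∈-nonneg A {f} 0≤f = subst (_≤ ∑∈ A f) (trans (∑∈-const A 0ℚ) (*-zeroʳ ⟦ card A ⟧)) (∑∈-mono A {λ _ → 0ℚ} {f} 0≤f)

∑∈-+ : ∀ {n} (A : Subset n) (f g : Fin n → ℚ) → ∑∈ A (λ u → f u + g u) ≡ ∑∈ A f + ∑∈ A g
∑∈-+ A f g = trans (sum-cong λ u → *-distribˡ-+ (χ A u) (f u) (g u)) (sum-+ (λ u → χ A u * f u) (λ u → χ A u * g u))

∑∈-* : ∀ {n} (A : Subset n) x (f : Fin n → ℚ) → ∑∈ A (λ u → x * f u) ≡ x * ∑∈ A f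
∑∈-* A x f = trans (sum-cong λ u → solve 3 (λ a x f → a :* (x :* f) := x :* (a :* f)) refl (χ A u) x (f u))
  (sum-*ˡ x (λ u → χ A u * f u))

∑∈-sum : ∀ {n m} (A : Subset n) (f : Fin m → Fin n → ℚ) →
  ∑∈ A (λ u → sum λ y → f y u) ≡ sum λ y → ∑∈ A (f y)
∑∈-sum A f = trans (sum-cong λ u → sym (sum-*ˡ (χ A u) (λ y → f y u))) (sum-comm (λ u y → χ A u * f y u))

∑∈≤sum : ∀ {n} (A : Subset n) {f : Fin n → ℚ} → (∀ u → 0ℚ ≤ f u) → ∑∈ A f ≤ sum f
∑∈≤sum A {f} 0≤f = sum-mono λ u → subst (χ A u * f u ≤_) (*-identityˡ (f u)) (*-mono-≤ʳ (0≤f u) (ind≤1 (lookup A u)))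

∑∈-∅ : ∀ {n} (f : Fin n → ℚ) → ∑∈ ∅ f ≡ 0ℚ
∑∈-∅ {zero} f = refl
∑∈-∅ {suc n} f = trans (cong₂ _+_ (*-zeroˡ (f zero)) (∑∈-∅ (f ∘ suc))) refl

∑∈-⁅⁆ : ∀ {n} v (f : Fin n → ℚ) → ∑∈ ⁅ v ⁆ f ≡ f v
∑∈-⁅⁆ zero f = trans (cong₂ _+_ (*-identityˡ (f zero)) (∑∈-∅ (f ∘ suc))) (+-identityʳ (f zero))
∑∈-⁅⁆ (suc v) f = trans (cong₂ _+_ (*-zeroˡ (f zero)) (∑∈-⁅⁆ v (f ∘ suc))) (+-identityˡ (f (suc v)))

χ-─ : ∀ {n} (A X : Subset n) → X ⊆ A → ∀ u → χ A u ≡ χ X u + χ (A ─ X) u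
χ-─ (a ∷ A) (x ∷ X) X⊆A (suc u) = χ-─ A X (drop-∷-⊆ X⊆A) u
χ-─ (a ∷ A) (false ∷ X) X⊆A zero = sym (+-identityˡ (ind a))
χ-─ (a ∷ A) (true ∷ X) X⊆A zero = χ-∈ (X⊆A here)

∑∈-─ : ∀ {n} {A X : Subset n} → X ⊆ A → ∀ f → ∑∈ A f ≡ ∑∈ X f + ∑∈ (A ─ X) f
∑∈-─ {A = A} {X} X⊆A f = trans
  (sum-cong λ u → trans (cong (_* f u) (χ-─ A X X⊆A u)) (*-distribʳ-+ (f u) (χ X u) (χ (A ─ X) u)))
  (sum-+ (λ u → χ X u * f u) (λ u → χ (A ─ X) u * f u))

card-─ : ∀ {n} {A X : Subset n} → X ⊆ A → card A ≡ card X ℕ.+ card (A ─ X)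
card-─ {A = A} {X} X⊆A = ⟦⟧-injective (begin-equality
  ⟦ card A ⟧                        ≡⟨ χ-card A ⟨
  sum (χ A)                           ≡⟨ sum-cong (χ-─ A X X⊆A) ⟩
  sum (λ u → χ X u + χ (A ─ X) u)     ≡⟨ sum-+ (χ X) (χ (A ─ X)) ⟩
  sum (χ X) + sum (χ (A ─ X))         ≡⟨ cong₂ _+_ (χ-card X) (χ-card (A ─ X)) ⟩
  ⟦ card X ⟧ + ⟦ card (A ─ X) ⟧   ≡⟨ ⟦⟧-+ (card X) (card (A ─ X)) ⟨
  ⟦ card X ℕ.+ card (A ─ X) ⟧       ∎)
  where
  open ≤-Reasoning
  ⟦⟧-injective : ∀ {a b} → ⟦ a ⟧ ≡ ⟦ b ⟧ → a ≡ b
  ⟦⟧-injective eq = ℕ.≤-antisym (⟦⟧-cancel-≤ (≤-reflexive eq)) (⟦⟧-cancel-≤ (≤-reflexive (sym eq)))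

∉-─ : ∀ {n} (A X : Subset n) {u} → u ∈ X → u ∉ A ─ X
∉-─ (a ∷ A) (true ∷ X) here ()
∉-─ (a ∷ A) (x ∷ X) (there u∈X) (there u∈A─X) = ∉-─ A X u∈X u∈A─X

card>0⇒nonempty : ∀ {n} (A : Subset n) → 0 ℕ.< card A → Nonempty A
card>0⇒nonempty (true ∷ A) _ = zero , here
card>0⇒nonempty (false ∷ A) p with card>0⇒nonempty A p
... | u , u∈A = suc u , there u∈A

argmin : ∀ {n} (A : Subset n) (f : Fin n → ℚ) → Nonempty A →
  ∃[ v ] v ∈ A × (∀ {u} → u ∈ A → f v ≤ f u)
argmin (a ∷ A) f ne with nonempty? A
argmin (a ∷ A) f (zero , here) | no empty =
  zero , here , λ { here → ≤-refl ; (there u∈A) → contradiction (_ , u∈A) empty }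
argmin (a ∷ A) f (suc u , there u∈A) | no empty = contradiction (u , u∈A) empty
argmin (a ∷ A) f ne | yes ne′ with argmin A (f ∘ suc) ne′
argmin (false ∷ A) f ne | yes ne′ | v , v∈A , min =
  suc v , there v∈A , λ { (there u∈A) → min u∈A }
argmin (true ∷ A) f ne | yes ne′ | v , v∈A , min with ≤-total (f zero) (f (suc v))
... | inj₁ f0≤fv = zero , here , λ { here → ≤-refl ; (there u∈A) → ≤-trans f0≤fv (min u∈A) }
... | inj₂ fv≤f0 = suc v , there v∈A , λ { here → fv≤f0 ; (there u∈A) → min u∈A }

below-average : ∀ {q} (f : Fin (suc q) → ℚ) → ∃[ x ] ⟦ suc q ⟧ * f x ≤ sum f
below-average {q} f with argmin full f (zero , ∈⊤)
... | x , _ , min = x , subst (_≤ sum f) (sum-const (suc q) (f x)) (sum-mono λ y → min (∈⊤ {x = y}))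

-- A vertex of least value is removed. If that value is nonpositive, the sum does not drop;
-- otherwise all remaining values are nonnegative.
remove-one : ∀ {n s} (A : Subset n) f → card A ≡ suc s → 0ℚ ≤ ∑∈ A f →
  ∃[ B ] B ⊆ A × card B ≡ s × 0ℚ ≤ ∑∈ B f
remove-one {s = s} A f |A| 0≤∑ with argmin A f (card>0⇒nonempty A (subst (0 ℕ.<_) (sym |A|) ℕ.z<s))
... | v , v∈A , min = A ∖ v , p─q⊆p A ⁅ v ⁆ , size , nonneg
  where
  ⁅v⁆⊆A : ⁅ v ⁆ ⊆ A
  ⁅v⁆⊆A u∈ = subst (_∈ A) (sym (x∈⁅y⁆⇒x≡y v u∈)) v∈A
  size : card (A ∖ v) ≡ s
  size = ℕ.suc-injective (trans (sym (trans (card-─ ⁅v⁆⊆A) (cong (ℕ._+ card (A ∖ v)) (∣⁅x⁆∣≡1 v)))) |A|)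
  nonneg : 0ℚ ≤ ∑∈ (A ∖ v) f
  nonneg with ≤-total (f v) 0ℚ
  ... | inj₂ 0≤fv = ∑∈-nonneg (A ∖ v) λ u∈ → ≤-trans 0≤fv (min (p─q⊆p A ⁅ v ⁆ u∈))
  ... | inj₁ fv≤0 = ≤-trans 0≤∑ (≤-by (- f v) (neg-antimono-≤ fv≤0) (begin-equality
    ∑∈ (A ∖ v) f                       ≡⟨ solve 2 (λ x y → y := x :+ y :- x) refl (f v) (∑∈ (A ∖ v) f) ⟩
    f v + ∑∈ (A ∖ v) f - f v           ≡⟨ cong (λ x → x + ∑∈ (A ∖ v) f - f v) (∑∈-⁅⁆ v f) ⟨
    ∑∈ ⁅ v ⁆ f + ∑∈ (A ∖ v) f - f v    ≡⟨ cong (_- f v) (∑∈-─ ⁅v⁆⊆A f) ⟨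
    ∑∈ A f - f v                       ∎))
    where open ≤-Reasoning

shrink : ∀ {n} m (A : Subset n) f → m ℕ.≤ card A → 0ℚ ≤ ∑∈ A f →
  ∃[ B ] B ⊆ A × card B ≡ m × 0ℚ ≤ ∑∈ B f
shrink m A f m≤|A| = go (card A ℕ.∸ m) A (sym (ℕ.m∸n+n≡m m≤|A|))
  where
  go : ∀ d A → card A ≡ d ℕ.+ m → 0ℚ ≤ ∑∈ A f → ∃[ B ] B ⊆ A × card B ≡ m × 0ℚ ≤ ∑∈ B f
  go zero A |A| 0≤∑ = A , (λ u∈A → u∈A) , |A| , 0≤∑
  go (suc d) A |A| 0≤∑ with remove-one A f |A| 0≤∑
  ... | B , B⊆A , |B| , 0≤∑′ with go d B |B| 0≤∑′
  ... | C , C⊆B , |C| , 0≤∑″ = C , ⊆-trans C⊆B B⊆A , |C| , 0≤∑″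

subset-of-size : ∀ {n} m (A : Subset n) → m ℕ.≤ card A → ∃[ B ] B ⊆ A × card B ≡ m
subset-of-size m A m≤|A| with shrink m A (λ _ → 0ℚ) m≤|A| (∑∈-nonneg A {λ _ → 0ℚ} λ _ → ≤-refl)
... | B , B⊆A , |B| , _ = B , B⊆A , |B|

-- `cover` is an identity of indicator functions, so that sums over `A` split by linearity without
-- deciding in which part a vertex lies.
record Blocks {n} (q m : ℕ) (A : Subset n) : Set where
  field
    part     : Fin q → Subset n
    size     : ∀ x → card (part x) ≡ m
    sub      : ∀ x → part x ⊆ A
    disjoint : ∀ x y → ¬ (x ≡ y) → Disjoint (part x) (part y)
    cover    : ∀ u → χ A u ≡ sum λ x → χ (part x) u
open Blocks

_◂_ : ∀ {n q m} {A X : Subset n} → (X ⊆ A × card X ≡ m) → Blocks q m (A ─ X) → Blocks (suc q) m A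
_◂_ {A = A} {X} (X⊆A , |X|) B = record
  { part = λ { zero → X ; (suc x) → part B x }
  ; size = λ { zero → |X| ; (suc x) → size B x }
  ; sub = λ { zero → X⊆A ; (suc x) u∈ → p─q⊆p A X (sub B x u∈) }
  ; disjoint = λ
    { zero zero 0≢0 → contradiction refl 0≢0
    ; zero (suc y) _ u (u∈X , u∈) → ∉-─ A X u∈X (sub B y u∈)
    ; (suc x) zero _ u (u∈ , u∈X) → ∉-─ A X u∈X (sub B x u∈)
    ; (suc x) (suc y) x≢y → disjoint B x y (x≢y ∘ cong suc) }
  ; cover = λ u → trans (χ-─ A X X⊆A u) (cong (_+_ (χ X u)) (cover B u)) }

blocks : ∀ {n} q m (A : Subset n) → card A ≡ q ℕ.* m → Blocks q m A
blocks zero m A |A| = record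
  { part = λ () ; size = λ () ; sub = λ () ; disjoint = λ ()
  -- There are no parts, so the right side is 0; the indicator is squeezed between 0 and `card A`,
  -- which is 0.
  ; cover = λ u → ≤-antisym
      (≤-trans (term≤sum (λ v → ind-nonneg (lookup A v)) u) (≤-reflexive (trans (χ-card A) (trans (cong ⟦_⟧ |A|) ⟦⟧-0))))
      (ind-nonneg (lookup A u)) }
blocks (suc q) m A |A| with subset-of-size m A (subst (m ℕ.≤_) (sym |A|) (ℕ.m≤m+n m (q ℕ.* m)))
... | X , X⊆A , |X| = (X⊆A , |X|) ◂ blocks q m (A ─ X)
  (ℕ.+-cancelˡ-≡ m _ _ (trans (cong (ℕ._+ card (A ─ X)) (sym |X|)) (trans (sym (card-─ X⊆A)) |A|)))

-- The prescribed block sits at index `zero`, so that both sides of an irregular pair carry their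
-- witnesses at a known place.
blocks-from : ∀ {n} q m (A X : Subset n) → card A ≡ suc q ℕ.* m → X ⊆ A → card X ≡ m →
  Σ (Blocks (suc q) m A) λ B → part B zero ≡ X
blocks-from q m A X |A| X⊆A |X| = (X⊆A , |X|) ◂ blocks q m (A ─ X)
  (ℕ.+-cancelˡ-≡ m _ _ (trans (cong (ℕ._+ card (A ─ X)) (sym |X|)) (trans (sym (card-─ X⊆A)) |A|))) , refl

bil : ∀ {n} → (Fin n → Fin n → ℚ) → Subset n → Subset n → ℚ
bil w A B = ∑∈ A λ u → ∑∈ B (w u)

∑∈-blocks : ∀ {n q m} {A : Subset n} (B : Blocks q m A) f → ∑∈ A f ≡ sum λ x → ∑∈ (part B x) f
∑∈-blocks {A = A} B f = trans
  (sum-cong λ u → trans (cong (_* f u) (cover B u)) (sym (sum-*ʳ (f u) (λ x → χ (part B x) u))))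
  (sum-comm (λ u x → χ (part B x) u * f u))

bil-blocks : ∀ {n q m q′ m′} {A A′ : Subset n} (B : Blocks q m A) (B′ : Blocks q′ m′ A′) w →
  bil w A A′ ≡ sum λ x → sum λ y → bil w (part B x) (part B′ y)
bil-blocks B B′ w = trans (∑∈-blocks B _) (sum-cong λ x →
  trans (∑∈-cong (part B x) λ u → ∑∈-blocks B′ (w u)) (∑∈-sum (part B x) λ y u → ∑∈ (part B′ y) (w u)))

bil-mono : ∀ {n} (A B : Subset n) {w w′ : Fin n → Fin n → ℚ} → (∀ u v → w u v ≤ w′ u v) → bil w A B ≤ bil w′ A B
bil-mono A B w≤w′ = ∑∈-mono A λ {u} _ → ∑∈-mono B λ {v} _ → w≤w′ u v

bil-const : ∀ {n} (A B : Subset n) x → bil (λ _ _ → x) A B ≡ ⟦ card A ⟧ * ⟦ card B ⟧ * x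
bil-const A B x = trans (∑∈-cong A λ _ → ∑∈-const B x) (trans (∑∈-const A _) (sym (*-assoc (⟦ card A ⟧) (⟦ card B ⟧) x)))

bil-+ : ∀ {n} (A B : Subset n) (w w′ : Fin n → Fin n → ℚ) →
  bil (λ u v → w u v + w′ u v) A B ≡ bil w A B + bil w′ A B
bil-+ A B w w′ = trans (∑∈-cong A λ u → ∑∈-+ B (w u) (w′ u)) (∑∈-+ A _ _)

bil-* : ∀ {n} (A B : Subset n) x (w : Fin n → Fin n → ℚ) → bil (λ u v → x * w u v) A B ≡ x * bil w A B
bil-* A B x w = trans (∑∈-cong A λ u → ∑∈-* B x (w u)) (∑∈-* A x _)

bil-comm : ∀ {n} (A B : Subset n) (w : Fin n → Fin n → ℚ) → bil w A B ≡ bil (λ v u → w u v) B A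
bil-comm A B w = begin-equality
  sum (λ u → χ A u * sum (λ v → χ B v * w u v))   ≡⟨ ∑∈-sum A (λ v u → χ B v * w u v) ⟩
  sum (λ v → ∑∈ A (λ u → χ B v * w u v))          ≡⟨ sum-cong (λ v → ∑∈-* A (χ B v) (λ u → w u v)) ⟩
  sum (λ v → χ B v * ∑∈ A (λ u → w u v))          ∎
  where open ≤-Reasoning

-- The sum over ordered pairs i ≠ j.
pairSum : ∀ {k} → (Fin k → Fin k → ℚ) → ℚ
pairSum {zero} ψ = 0ℚ
pairSum {suc k} ψ = sum (λ j → ψ zero (suc j) + ψ (suc j) zero) + pairSum (λ i j → ψ (suc i) (suc j))

pairSum-mono : ∀ {k} {ψ ψ′ : Fin k → Fin k → ℚ} → (∀ i j → ¬ (i ≡ j) → ψ i j ≤ ψ′ i j) → pairSum ψ ≤ pairSum ψ′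
pairSum-mono {zero} _ = ≤-refl
pairSum-mono {suc k} {ψ} le = +-mono-≤ (sum-mono λ j → +-mono-≤ (le zero (suc j) λ ()) (le (suc j) zero λ ()))
  (pairSum-mono {ψ = λ i j → ψ (suc i) (suc j)} λ i j i≢j → le (suc i) (suc j) (λ { refl → i≢j refl }))

pairSum-+ : ∀ {k} (ψ ψ′ : Fin k → Fin k → ℚ) → pairSum (λ i j → ψ i j + ψ′ i j) ≡ pairSum ψ + pairSum ψ′
pairSum-+ {zero} ψ ψ′ = refl
pairSum-+ {suc k} ψ ψ′ = trans (cong₂ _+_
  (trans (sum-cong λ j → interchange (ψ zero (suc j)) (ψ′ zero (suc j)) (ψ (suc j) zero) (ψ′ (suc j) zero))
         (sum-+ (λ j → ψ zero (suc j) + ψ (suc j) zero) (λ j → ψ′ zero (suc j) + ψ′ (suc j) zero)))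
  (pairSum-+ (λ i j → ψ (suc i) (suc j)) (λ i j → ψ′ (suc i) (suc j))))
  (interchange (sum λ j → ψ zero (suc j) + ψ (suc j) zero) (sum λ j → ψ′ zero (suc j) + ψ′ (suc j) zero)
    (pairSum λ i j → ψ (suc i) (suc j)) (pairSum λ i j → ψ′ (suc i) (suc j)))

pairSum-* : ∀ {k} x (ψ : Fin k → Fin k → ℚ) → pairSum (λ i j → x * ψ i j) ≡ x * pairSum ψ
pairSum-* {zero} x ψ = sym (*-zeroʳ x)
pairSum-* {suc k} x ψ = trans (cong₂ _+_
  (trans (sum-cong λ j → sym (*-distribˡ-+ x (ψ zero (suc j)) (ψ (suc j) zero)))
         (sum-*ˡ x (λ j → ψ zero (suc j) + ψ (suc j) zero)))
  (pairSum-* x (λ i j → ψ (suc i) (suc j))))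
  (sym (*-distribˡ-+ x _ _))

pairSum-nonneg : ∀ {k} (ψ : Fin k → Fin k → ℚ) → (∀ i j → 0ℚ ≤ ψ i j) → 0ℚ ≤ pairSum ψ
pairSum-nonneg {zero} ψ 0≤ψ = ≤-refl
pairSum-nonneg {suc k} ψ 0≤ψ = +-nonneg (sum-nonneg λ j → +-nonneg (0≤ψ zero (suc j)) (0≤ψ (suc j) zero))
  (pairSum-nonneg (λ i j → ψ (suc i) (suc j)) λ i j → 0≤ψ (suc i) (suc j))

pairSum-diagonal : ∀ {k} (ψ : Fin k → Fin k → ℚ) → sum (λ i → sum (ψ i)) ≡ sum (λ i → ψ i i) + pairSum ψ
pairSum-diagonal {zero} ψ = refl
pairSum-diagonal {suc k} ψ = begin-equality
  ψ₀₀ + row + sum (λ i → ψ (suc i) zero + sum (λ j → ψ (suc i) (suc j)))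
    ≡⟨ cong (_+_ (ψ₀₀ + row)) (sum-+ (λ i → ψ (suc i) zero) _) ⟩
  ψ₀₀ + row + (column + sum (λ i → sum (λ j → ψ (suc i) (suc j))))
    ≡⟨ cong (λ x → ψ₀₀ + row + (column + x)) (pairSum-diagonal (λ i j → ψ (suc i) (suc j))) ⟩
  ψ₀₀ + row + (column + (diagonal + rest))
    ≡⟨ solve 5 (λ a b c d e → a :+ b :+ (c :+ (d :+ e)) := a :+ d :+ (b :+ c :+ e)) refl ψ₀₀ row column diagonal rest ⟩
  ψ₀₀ + diagonal + (row + column + rest)
    ≡⟨ cong (λ x → ψ₀₀ + diagonal + (x + rest)) (sum-+ (λ j → ψ zero (suc j)) (λ j → ψ (suc j) zero)) ⟨
  ψ₀₀ + diagonal + (sum (λ j → ψ zero (suc j) + ψ (suc j) zero) + rest) ∎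
  where
  open ≤-Reasoning
  ψ₀₀ = ψ zero zero
  row = sum λ j → ψ zero (suc j)
  column = sum λ j → ψ (suc j) zero
  diagonal = sum λ i → ψ (suc i) (suc i)
  rest = pairSum λ i j → ψ (suc i) (suc j)

term≤pairSum : ∀ {k} (ψ : Fin k → Fin k → ℚ) → (∀ i j → 0ℚ ≤ ψ i j) → ∀ a b → ¬ (a ≡ b) → ψ a b ≤ pairSum ψ
term≤pairSum ψ 0≤ψ zero zero 0≢0 = contradiction refl 0≢0
term≤pairSum ψ 0≤ψ zero (suc b) _ = ≤-trans (≤-addʳ (ψ zero (suc b)) (0≤ψ (suc b) zero))
  (≤-trans (term≤sum (λ j → +-nonneg (0≤ψ zero (suc j)) (0≤ψ (suc j) zero)) b)
    (≤-addʳ _ (pairSum-nonneg (λ i j → ψ (suc i) (suc j)) λ i j → 0≤ψ (suc i) (suc j))))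
term≤pairSum ψ 0≤ψ (suc a) zero _ = ≤-trans (≤-addˡ (ψ (suc a) zero) (0≤ψ zero (suc a)))
  (≤-trans (term≤sum (λ j → +-nonneg (0≤ψ zero (suc j)) (0≤ψ (suc j) zero)) a)
    (≤-addʳ _ (pairSum-nonneg (λ i j → ψ (suc i) (suc j)) λ i j → 0≤ψ (suc i) (suc j))))
term≤pairSum ψ 0≤ψ (suc a) (suc b) a≢b = ≤-trans
  (term≤pairSum (λ i j → ψ (suc i) (suc j)) (λ i j → 0≤ψ (suc i) (suc j)) a b (a≢b ∘ cong suc))
  (≤-addˡ _ (sum-nonneg λ j → +-nonneg (0≤ψ zero (suc j)) (0≤ψ (suc j) zero)))

-- Averaging over choices of blocks, and Turán's theorem

-- Method of conditional expectations: fix the choice for one index after the other, moving the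
-- interactions with the fixed index into the unary terms ψ.
averaging : ∀ {k q} (ψ : Fin k → Fin (suc q) → ℚ) (φ : Fin k → Fin k → Fin (suc q) → Fin (suc q) → ℚ) →
  Σ (Fin k → Fin (suc q)) λ β → ⟦ suc q ⟧ * ⟦ suc q ⟧ * (sum (λ i → ψ i (β i)) + pairSum (λ i j → φ i j (β i) (β j)))
    ≤ ⟦ suc q ⟧ * sum (λ i → sum (ψ i)) + pairSum (λ i j → sum λ x → sum λ y → φ i j x y)
averaging {zero} {q} ψ φ = (λ ()) ,
  ≤-reflexive (solve 1 (λ Q → Q :* Q :* (con 0ℚ :+ con 0ℚ) := Q :* con 0ℚ :+ con 0ℚ) refl ⟦ suc q ⟧)
averaging {suc k} {q} ψ φ = β , bound
  where
  Q = ⟦ suc q ⟧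
  cross : Fin k → Fin (suc q) → Fin (suc q) → ℚ
  cross j x y = φ zero (suc j) x y + φ (suc j) zero y x
  -- Up to the factor `Q`, this is the expectation of all terms involving the first index when its
  -- choice is `x` and the other choices are uniform.
  F : Fin (suc q) → ℚ
  F x = Q * ψ zero x + sum λ j → sum (cross j x)
  x₀ = proj₁ (below-average F)
  QFx₀≤∑F = proj₂ (below-average F)
  ψ′ : Fin k → Fin (suc q) → ℚ
  ψ′ j y = ψ (suc j) y + cross j x₀ y
  φ′ : Fin k → Fin k → Fin (suc q) → Fin (suc q) → ℚ
  φ′ i j = φ (suc i) (suc j)
  rec = averaging ψ′ φ′
  β′ = proj₁ rec
  β : Fin (suc k) → Fin (suc q)
  β zero = x₀
  β (suc i) = β′ i
  A = sum λ j → ψ (suc j) (β′ j)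
  C = sum λ j → cross j x₀ (β′ j)
  R = pairSum λ i j → φ′ i j (β′ i) (β′ j)
  A̅ = sum λ j → sum (ψ (suc j))
  C₀ = sum λ j → sum (cross j x₀)
  C̅ = sum λ j → (sum λ x → sum λ y → φ zero (suc j) x y) + (sum λ x → sum λ y → φ (suc j) zero x y)
  R̅ = pairSum λ i j → sum λ x → sum λ y → φ′ i j x y
  ∑F : sum F ≡ Q * sum (ψ zero) + C̅
  ∑F = trans (sum-+ (λ x → Q * ψ zero x) (λ x → sum λ j → sum (cross j x)))
    (cong₂ _+_ (sum-*ˡ Q (ψ zero)) (trans (sum-comm λ x j → sum (cross j x)) (sum-cong λ j →
      trans (sum-cong λ x → sum-+ (φ zero (suc j) x) (λ y → φ (suc j) zero y x))
      (trans (sum-+ (λ x → sum (φ zero (suc j) x)) (λ x → sum λ y → φ (suc j) zero y x))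
        (cong (_+_ (sum λ x → sum (φ zero (suc j) x))) (sum-comm λ x y → φ (suc j) zero y x))))))
  open ≤-Reasoning
  bound : Q * Q * ((ψ zero x₀ + A) + (C + R)) ≤ Q * (sum (ψ zero) + A̅) + (C̅ + R̅)
  bound = begin
    Q * Q * ((ψ zero x₀ + A) + (C + R))
      ≡⟨ solve 5 (λ Q p A C R → Q :* Q :* ((p :+ A) :+ (C :+ R)) := Q :* (Q :* p) :+ Q :* Q :* ((A :+ C) :+ R)) refl Q (ψ zero x₀) A C R ⟩
    Q * (Q * ψ zero x₀) + Q * Q * ((A + C) + R)
      ≡⟨ cong (λ z → Q * (Q * ψ zero x₀) + Q * Q * (z + R)) (sum-+ (λ j → ψ (suc j) (β′ j)) (λ j → cross j x₀ (β′ j))) ⟨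
    Q * (Q * ψ zero x₀) + Q * Q * (sum (λ j → ψ′ j (β′ j)) + R)
      ≤⟨ +-monoʳ-≤ (Q * (Q * ψ zero x₀)) (proj₂ rec) ⟩
    Q * (Q * ψ zero x₀) + (Q * sum (λ j → sum (ψ′ j)) + R̅)
      ≡⟨ cong (λ z → Q * (Q * ψ zero x₀) + (Q * z + R̅))
          (trans (sum-cong λ j → sum-+ (ψ (suc j)) (cross j x₀)) (sum-+ (λ j → sum (ψ (suc j))) (λ j → sum (cross j x₀)))) ⟩
    Q * (Q * ψ zero x₀) + (Q * (A̅ + C₀) + R̅)
      ≡⟨ solve 5 (λ Q p A C R → Q :* p :+ (Q :* (A :+ C) :+ R) := Q :* (p :+ C) :+ (Q :* A :+ R)) refl Q (Q * ψ zero x₀) A̅ C₀ R̅ ⟩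
    Q * F x₀ + (Q * A̅ + R̅)
      ≤⟨ +-monoˡ-≤ (Q * A̅ + R̅) QFx₀≤∑F ⟩
    sum F + (Q * A̅ + R̅)
      ≡⟨ cong (_+ (Q * A̅ + R̅)) ∑F ⟩
    Q * sum (ψ zero) + C̅ + (Q * A̅ + R̅)
      ≡⟨ solve 5 (λ Q p A C R → Q :* p :+ C :+ (Q :* A :+ R) := Q :* (p :+ A) :+ (C :+ R)) refl Q (sum (ψ zero)) A̅ C̅ R̅ ⟩
    Q * (sum (ψ zero) + A̅) + (C̅ + R̅) ∎

averaging-pairs : ∀ {k q} (φ : Fin k → Fin k → Fin (suc q) → Fin (suc q) → ℚ) →
  Σ (Fin k → Fin (suc q)) λ β → ⟦ suc q ⟧ * ⟦ suc q ⟧ * pairSum (λ i j → φ i j (β i) (β j)) ≤ pairSum (λ i j → sum λ x → sum λ y → φ i j x y)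
averaging-pairs {k} {q} φ = proj₁ av , subst₂ _≤_
  (cong (⟦ suc q ⟧ * ⟦ suc q ⟧ *_) (trans (cong (_+ P) (sum-0 k)) (+-identityˡ P)))
  (trans (cong (λ z → ⟦ suc q ⟧ * z + P̅) (trans (sum-cong λ (_ : Fin k) → sum-0 (suc q)) (sum-0 k)))
    (trans (cong (_+ P̅) (*-zeroʳ ⟦ suc q ⟧)) (+-identityˡ P̅)))
  (proj₂ av)
  where
  sum-0 : ∀ n → sum {n} (λ _ → 0ℚ) ≡ 0ℚ
  sum-0 n = trans (sum-const n 0ℚ) (*-zeroʳ ⟦ n ⟧)
  av = averaging (λ _ _ → 0ℚ) φ
  P = pairSum λ i j → φ i j (proj₁ av i) (proj₁ av j)
  P̅ = pairSum λ i j → sum λ x → sum λ y → φ i j x y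

-- The energy increment: the mean square of the block densities exceeds the square of their mean by
-- exactly the variance, so a single deviating block already gives a gain.
variance : ∀ {q} (d : Fin q → Fin q → ℚ) μ → sum (λ x → sum (d x)) ≡ ⟦ q ⟧ * ⟦ q ⟧ * μ →
  sum (λ x → sum λ y → d x y * d x y) ≡ ⟦ q ⟧ * ⟦ q ⟧ * (μ * μ) + sum (λ x → sum λ y → (d x y - μ) * (d x y - μ))
variance {q} d μ mean = begin-equality
  D²                              ≡⟨ solve 3 (λ Q μ D → D := Q :* Q :* (μ :* μ) :+ (D :+ ((:- (μ :+ μ)) :* (Q :* Q :* μ) :+ Q :* (Q :* (μ :* μ))))) refl Q μ D² ⟩
  Q * Q * (μ * μ) + (D² + (- (μ + μ) * (Q * Q * μ) + Q * (Q * (μ * μ))))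
    ≡⟨ cong (λ z → Q * Q * (μ * μ) + (D² + (- (μ + μ) * z + Q * (Q * (μ * μ))))) mean ⟨
  Q * Q * (μ * μ) + (D² + (- (μ + μ) * sum (λ x → sum (d x)) + Q * (Q * (μ * μ))))
    ≡⟨ cong (_+_ (Q * Q * (μ * μ))) expand ⟨
  Q * Q * (μ * μ) + sum (λ x → sum λ y → (d x y - μ) * (d x y - μ)) ∎
  where
  open ≤-Reasoning
  Q = ⟦ q ⟧
  D² = sum λ x → sum λ y → d x y * d x y
  row : ∀ x → sum (λ y → (d x y - μ) * (d x y - μ)) ≡ sum (λ y → d x y * d x y) + (- (μ + μ) * sum (d x) + Q * (μ * μ))
  row x = begin-equality
    sum (λ y → (d x y - μ) * (d x y - μ))
      ≡⟨ sum-cong (λ y → solve 2 (λ d μ → (d :- μ) :* (d :- μ) := d :* d :+ ((:- (μ :+ μ)) :* d :+ μ :* μ)) refl (d x y) μ) ⟩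
    sum (λ y → d x y * d x y + (- (μ + μ) * d x y + μ * μ))
      ≡⟨ sum-+ (λ y → d x y * d x y) (λ y → - (μ + μ) * d x y + μ * μ) ⟩
    sum (λ y → d x y * d x y) + sum (λ y → - (μ + μ) * d x y + μ * μ)
      ≡⟨ cong (_+_ (sum (λ y → d x y * d x y))) (trans (sum-+ (λ y → - (μ + μ) * d x y) (λ y → μ * μ))
          (cong₂ _+_ (sum-*ˡ (- (μ + μ)) (d x)) (sum-const q (μ * μ)))) ⟩
    sum (λ y → d x y * d x y) + (- (μ + μ) * sum (d x) + Q * (μ * μ)) ∎
  expand : sum (λ x → sum λ y → (d x y - μ) * (d x y - μ)) ≡ D² + (- (μ + μ) * sum (λ x → sum (d x)) + Q * (Q * (μ * μ)))
  expand = begin-equality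
    sum (λ x → sum λ y → (d x y - μ) * (d x y - μ)) ≡⟨ sum-cong row ⟩
    sum (λ x → sum (λ y → d x y * d x y) + (- (μ + μ) * sum (d x) + Q * (μ * μ)))
      ≡⟨ sum-+ (λ x → sum (λ y → d x y * d x y)) (λ x → - (μ + μ) * sum (d x) + Q * (μ * μ)) ⟩
    D² + sum (λ x → - (μ + μ) * sum (d x) + Q * (μ * μ))
      ≡⟨ cong (_+_ D²) (trans (sum-+ (λ x → - (μ + μ) * sum (d x)) (λ x → Q * (μ * μ)))
          (cong₂ _+_ (sum-*ˡ (- (μ + μ)) (λ x → sum (d x))) (sum-const q (Q * (μ * μ))))) ⟩
    D² + (- (μ + μ) * sum (λ x → sum (d x)) + Q * (Q * (μ * μ))) ∎

∑∈-⊆ : ∀ {n} {A B : Subset n} → A ⊆ B → ∀ {f} → (∀ u → 0ℚ ≤ f u) → ∑∈ A f ≤ ∑∈ B f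
∑∈-⊆ {A = A} {B} A⊆B {f} 0≤f = subst (∑∈ A f ≤_) (sym (∑∈-─ A⊆B f)) (≤-addʳ (∑∈ A f) (∑∈-nonneg (B ─ A) λ {u} _ → 0≤f u))

square≤0⇒≡0 : ∀ {p} → 0ℚ ≤ p → p * p ≤ 0ℚ → p ≡ 0ℚ
square≤0⇒≡0 {p} 0≤p p²≤0 with p ≤? 0ℚ
... | yes p≤0 = ≤-antisym p≤0 0≤p
... | no p≰0 = contradiction (<-≤-trans (*-pos (≰⇒> p≰0) (≰⇒> p≰0)) p²≤0) (<-irrefl refl)

-- Cauchy-Schwarz in the form σ (a + ν)² ≤ (1 + σ)(a² + σ ν²), with difference (a - σ ν)². For s = 0
-- the bound on a² forces a = 0.
turan-step : ∀ s {a ν N N′} → 0ℚ ≤ a → 0ℚ ≤ N′ → a * a ≤ ⟦ s ⟧ * N′ → N′ + ν * ν ≤ N → (a + ν) * (a + ν) ≤ ⟦ suc s ⟧ * N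
turan-step zero {a} {ν} {N} {N′} 0≤a 0≤N′ ih le = begin
  (a + ν) * (a + ν)   ≡⟨ cong (λ z → (z + ν) * (z + ν)) a≡0 ⟩
  (0ℚ + ν) * (0ℚ + ν) ≡⟨ solve 1 (λ ν → (con 0ℚ :+ ν) :* (con 0ℚ :+ ν) := ν :* ν) refl ν ⟩
  ν * ν               ≤⟨ ≤-addˡ (ν * ν) 0≤N′ ⟩
  N′ + ν * ν          ≤⟨ le ⟩
  N                   ≡⟨ *-identityˡ N ⟨
  1ℚ * N              ≡⟨ cong (_* N) ⟦⟧-1 ⟨
  ⟦ 1 ⟧ * N           ∎
  where
  open ≤-Reasoning
  a≡0 : a ≡ 0ℚ
  a≡0 = square≤0⇒≡0 0≤a (≤-trans ih (≤-reflexive (trans (cong (_* N′) ⟦⟧-0) (*-zeroˡ N′))))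
turan-step (suc s) {a} {ν} {N} {N′} 0≤a 0≤N′ ih le = *-cancel-≤ˡ 0<σ (begin
  σ * ((a + ν) * (a + ν)) ≤⟨ ≤-by ((a - σ * ν) * (a - σ * ν)) (square-nonneg (a - σ * ν))
     (solve 3 (λ a ν σ → (con 1ℚ :+ σ) :* (a :* a :+ σ :* (ν :* ν)) := σ :* ((a :+ ν) :* (a :+ ν)) :+ (a :- σ :* ν) :* (a :- σ :* ν)) refl a ν σ) ⟩
  (1ℚ + σ) * (a * a + σ * (ν * ν)) ≤⟨ *-mono-≤ˡ 0≤1+σ (+-monoˡ-≤ (σ * (ν * ν)) ih) ⟩
  (1ℚ + σ) * (σ * N′ + σ * (ν * ν)) ≡⟨ solve 3 (λ σ N M → (con 1ℚ :+ σ) :* (σ :* N :+ σ :* M) := (con 1ℚ :+ σ) :* σ :* (N :+ M)) refl σ N′ (ν * ν) ⟩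
  (1ℚ + σ) * σ * (N′ + ν * ν) ≤⟨ *-mono-≤ˡ (*-nonneg 0≤1+σ 0≤σ) le ⟩
  (1ℚ + σ) * σ * N ≡⟨ solve 2 (λ σ N → (con 1ℚ :+ σ) :* σ :* N := σ :* ((con 1ℚ :+ σ) :* N)) refl σ N ⟩
  σ * ((1ℚ + σ) * N) ≡⟨ cong (λ z → σ * (z * N)) (⟦⟧-suc (suc s)) ⟨
  σ * (⟦ suc (suc s) ⟧ * N) ∎)
  where
  open ≤-Reasoning
  σ = ⟦ suc s ⟧
  0<σ : 0ℚ < σ
  0<σ = subst (_< σ) ⟦⟧-0 (⟦⟧-< (ℕ.z<s {s}))
  0≤σ = <⇒≤ 0<σ
  0≤1+σ : 0ℚ ≤ 1ℚ + σ
  0≤1+σ = +-nonneg (nonNegative⁻¹ 1ℚ) 0≤σ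

-- `b` marks the non-adjacent pairs; since it will be true on the diagonal, `f` is then injective
-- automatically.
Clique : ∀ {k} → (Fin k → Fin k → Bool) → ℕ → Subset k → Set
Clique {k} b t S = Σ (Fin t → Fin k) λ f → (∀ i → f i ∈ S) × (∀ i j → i Fin.< j → b (f i) (f j) ≡ false)

cons-clique : ∀ {k t} {b : Fin k → Fin k → Bool} {S S′ : Subset k} {v} → v ∈ S → S′ ⊆ S →
  (∀ {j} → j ∈ S′ → b v j ≡ false) → Clique b t S′ → Clique b (suc t) S
cons-clique {t = t} {b} {S} {v = v} v∈S S′⊆S nbr (f , f∈ , fadj) = g , g∈ , gadj
  where
  g : Fin (suc t) → _
  g zero = v
  g (suc i) = f i
  g∈ : ∀ i → g i ∈ S
  g∈ zero = v∈S
  g∈ (suc i) = S′⊆S (f∈ i)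
  gadj : ∀ i j → i Fin.< j → b (g i) (g j) ≡ false
  gadj zero (suc j) _ = nbr (f∈ j)
  gadj (suc i) (suc j) (ℕ.s≤s i<j) = fadj i j i<j

-- Delete a vertex v of minimal co-degree ν together with its ν non-neighbours and recurse into
-- the neighbourhood of v; each deleted vertex lies in at least ν non-adjacent pairs.
turan : ∀ {k} (b : Fin k → Fin k → Bool) s (S : Subset k) →
  Clique b (suc s) S ⊎ ⟦ card S ⟧ * ⟦ card S ⟧ ≤ ⟦ s ⟧ * bil (λ i j → ind (b i j)) S S
turan b s S with nonempty? S
turan {k} b s S | no empty = inj₂ (subst (_≤ ⟦ s ⟧ * N) (sym square≡0)
    (*-nonneg (⟦⟧-nonneg s) (∑∈-nonneg S λ {i} _ → ∑∈-nonneg S λ {j} _ → ind-nonneg (b i j))))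
  where
  N = bil (λ i j → ind (b i j)) S S
  square≡0 : ⟦ card S ⟧ * ⟦ card S ⟧ ≡ 0ℚ
  square≡0 = trans (cong (λ A → ⟦ card A ⟧ * ⟦ card A ⟧) (Empty-unique empty))
    (trans (cong (λ c → ⟦ c ⟧ * ⟦ c ⟧) (∣⊥∣≡0 k)) (cong (λ c → c * c) ⟦⟧-0))
turan b zero S | yes (v , v∈S) = inj₁ ((λ _ → v) , (λ _ → v∈S) , λ { zero zero () })
turan {k} b (suc s) S | yes ne = result
  where
  w : Fin k → Fin k → ℚ
  w i j = ind (b i j)
  codeg : Fin k → ℚ
  codeg i = ∑∈ S (w i)
  least = argmin S codeg ne
  v = proj₁ least
  ν = codeg v
  S′ : Subset k
  S′ = tabulate λ j → lookup S j ∧ not (b v j)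
  S′-spec : ∀ {j} → j ∈ S′ → lookup S j ∧ not (b v j) ≡ true
  S′-spec {j} j∈ = trans (sym (lookup∘tabulate (λ j → lookup S j ∧ not (b v j)) j)) ([]=⇒lookup j∈)
  S′⊆S : S′ ⊆ S
  S′⊆S {j} j∈ = lookup⇒[]= j S (∧-left (S′-spec j∈))
    where
    ∧-left : ∀ {x y} → x ∧ y ≡ true → x ≡ true
    ∧-left {true} _ = refl
  nbr : ∀ {j} → j ∈ S′ → b v j ≡ false
  nbr {j} j∈ = ∧-right (lookup S j) (S′-spec j∈)
    where
    ∧-right : ∀ x {y} → x ∧ not y ≡ true → y ≡ false
    ∧-right true {false} _ = refl
  χS′ : ∀ j → χ S j ≡ χ S′ j + χ S j * w v j
  χS′ j = trans (split (lookup S j) (b v j))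
    (cong (λ x → ind x + χ S j * w v j) (sym (lookup∘tabulate (λ j → lookup S j ∧ not (b v j)) j)))
    where
    split : ∀ x y → ind x ≡ ind (x ∧ not y) + ind x * ind y
    split true true = refl
    split true false = refl
    split false true = refl
    split false false = refl
  |S| : ⟦ card S ⟧ ≡ ⟦ card S′ ⟧ + ν
  |S| = trans (sym (χ-card S)) (trans (sum-cong χS′) (trans (sum-+ (χ S′) (λ j → χ S j * w v j)) (cong (_+ ν) (χ-card S′))))
  -- ν is at once the number of deleted vertices and, by minimality, a lower bound for the co-degree
  -- of each: this yields the ν² in `N≥`.
  |S─S′| : ⟦ card (S ─ S′) ⟧ ≡ ν
  |S─S′| = +-cancelˡ ⟦ card S′ ⟧ (trans (sym (⟦⟧-+ (card S′) (card (S ─ S′)))) (trans (cong ⟦_⟧ (sym (card-─ S′⊆S))) |S|))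
    where
    +-cancelˡ : ∀ x {y z} → x + y ≡ x + z → y ≡ z
    +-cancelˡ x {y} {z} eq = trans (undo x y) (trans (cong (_- x) eq) (sym (undo x z)))
      where
      undo : ∀ x y → y ≡ x + y - x
      undo = solve 2 (λ x y → y := x :+ y :- x) refl
  0≤w : ∀ i j → 0ℚ ≤ w i j
  0≤w i j = ind-nonneg (b i j)
  N≥ : bil w S′ S′ + ν * ν ≤ bil w S S
  N≥ = begin
    bil w S′ S′ + ν * ν                ≡⟨ cong (λ z → bil w S′ S′ + z * ν) |S─S′| ⟨
    bil w S′ S′ + ⟦ card (S ─ S′) ⟧ * ν ≡⟨ cong (_+_ (bil w S′ S′)) (∑∈-const (S ─ S′) ν) ⟨
    bil w S′ S′ + ∑∈ (S ─ S′) (λ _ → ν) ≤⟨ +-mono-≤ (∑∈-mono S′ λ {i} _ → ∑∈-⊆ S′⊆S (0≤w i))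
                                            (∑∈-mono (S ─ S′) λ i∈ → proj₂ (proj₂ least) (p─q⊆p S S′ i∈)) ⟩
    ∑∈ S′ codeg + ∑∈ (S ─ S′) codeg    ≡⟨ ∑∈-─ S′⊆S codeg ⟨
    bil w S S                          ∎
    where open ≤-Reasoning
  result : Clique b (suc (suc s)) S ⊎ ⟦ card S ⟧ * ⟦ card S ⟧ ≤ ⟦ suc s ⟧ * bil w S S
  result with turan b s S′
  ... | inj₁ clique = inj₁ (cons-clique {b = b} (proj₁ (proj₂ least)) S′⊆S nbr clique)
  ... | inj₂ ih = inj₂ (subst (λ z → z * z ≤ ⟦ suc s ⟧ * bil w S S) (sym |S|)
    (turan-step s (⟦⟧-nonneg (card S′)) (∑∈-nonneg S′ λ {i} _ → ∑∈-nonneg S′ λ {j} _ → 0≤w i j) ih N≥))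

-- Densities and irregular pairs

opaque
  -- Densities between sets of size L are written as products with 1/L², so that the ring solver,
  -- which knows no division, can handle them.
  inv : ℕ → ℚ
  inv L = frac 1 (L ℕ.* L)

  inv-* : ∀ {L} → 0 ℕ.< L → inv L * (⟦ L ⟧ * ⟦ L ⟧) ≡ 1ℚ
  inv-* {L} 0<L = trans (cong (inv L *_) (sym (⟦⟧-* L L))) (trans (frac-* 1 (L ℕ.* L) (ℕ.*-mono-≤ 0<L 0<L)) ⟦⟧-1)

  frac-inv : ∀ p {L} → 0 ℕ.< L → frac p (L ℕ.* L) ≡ ⟦ p ⟧ * inv L
  frac-inv p {L} 0<L = begin-equality
    frac p (L ℕ.* L)                                ≡⟨ *-identityʳ _ ⟨
    frac p (L ℕ.* L) * 1ℚ                           ≡⟨ cong (frac p (L ℕ.* L) *_) (inv-* 0<L) ⟨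
    frac p (L ℕ.* L) * (inv L * (⟦ L ⟧ * ⟦ L ⟧))    ≡⟨ solve 3 (λ x y z → x :* (y :* z) := x :* z :* y) refl (frac p (L ℕ.* L)) (inv L) (⟦ L ⟧ * ⟦ L ⟧) ⟩
    frac p (L ℕ.* L) * (⟦ L ⟧ * ⟦ L ⟧) * inv L      ≡⟨ cong (λ z → frac p (L ℕ.* L) * z * inv L) (⟦⟧-* L L) ⟨
    frac p (L ℕ.* L) * ⟦ L ℕ.* L ⟧ * inv L          ≡⟨ cong (_* inv L) (frac-* p (L ℕ.* L) (ℕ.*-mono-≤ 0<L 0<L)) ⟩
    ⟦ p ⟧ * inv L                                   ∎
    where open ≤-Reasoning

-- `inv-*` makes `inv L` equal to L² times its own square.
inv-nonneg : ∀ {L} → 0 ℕ.< L → 0ℚ ≤ inv L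
inv-nonneg {L} 0<L = subst (0ℚ ≤_) eq (*-nonneg (*-nonneg (⟦⟧-nonneg L) (⟦⟧-nonneg L)) (square-nonneg (inv L)))
  where
  eq : ⟦ L ⟧ * ⟦ L ⟧ * (inv L * inv L) ≡ inv L
  eq = trans (solve 2 (λ x y → x :* (y :* y) := y :* x :* y) refl (⟦ L ⟧ * ⟦ L ⟧) (inv L))
    (trans (cong (_* inv L) (inv-* 0<L)) (*-identityˡ (inv L)))

inv-scale : ∀ q m → 0 ℕ.< q → 0 ℕ.< m → inv m ≡ ⟦ q ⟧ * ⟦ q ⟧ * inv (q ℕ.* m)
inv-scale q m 0<q 0<m = begin-equality
  x                                 ≡⟨ *-identityʳ x ⟨
  x * 1ℚ                            ≡⟨ cong (x *_) (inv-* {q ℕ.* m} (ℕ.*-mono-≤ 0<q 0<m)) ⟨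
  x * (y * (⟦ q ℕ.* m ⟧ * ⟦ q ℕ.* m ⟧)) ≡⟨ cong (λ z → x * (y * (z * z))) (⟦⟧-* (q) m) ⟩
  x * (y * (Q * M * (Q * M)))       ≡⟨ solve 4 (λ x y Q M → x :* (y :* (Q :* M :* (Q :* M))) := x :* (M :* M) :* (Q :* Q :* y)) refl x y Q M ⟩
  x * (M * M) * (Q * Q * y)         ≡⟨ cong (_* (Q * Q * y)) (inv-* 0<m) ⟩
  1ℚ * (Q * Q * y)                  ≡⟨ *-identityˡ _ ⟩
  Q * Q * y                         ∎
  where
  open ≤-Reasoning
  x = inv m
  y = inv (q ℕ.* m)
  Q = ⟦ q ⟧
  M = ⟦ m ⟧

edge : ∀ {n} → Graph n → Fin n → Fin n → ℚ
edge H u v = ind (adj H u v)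

⟦e⟧ : ∀ {n} (H : Graph n) A B → ⟦ e H A B ⟧ ≡ bil (edge H) A B
⟦e⟧ {n} H A B = trans (⟦⟧-sum λ u → sumFin (count u)) (sum-cong λ u → trans (⟦⟧-sum (count u))
  (trans (sum-cong λ v → term (lookup A u) (lookup B v) (adj H u v)) (sum-*ˡ (χ A u) (λ v → χ B v * edge H u v))))
  where
  count : Fin n → Fin n → ℕ
  count u v = if lookup A u ∧ lookup B v ∧ adj H u v then 1 else 0
  term : ∀ x y z → ⟦ if x ∧ y ∧ z then 1 else 0 ⟧ ≡ ind x * (ind y * ind z)
  term true true true = ⟦⟧-1
  term true true false = ⟦⟧-0
  term true false z = trans ⟦⟧-0 (sym (trans (*-identityˡ _) (*-zeroˡ (ind z))))
  term false y z = trans ⟦⟧-0 (sym (*-zeroˡ (ind y * ind z)))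

density-inv : ∀ {n} (H : Graph n) (A B : Subset n) {L} → 0 ℕ.< L → card A ≡ L → card B ≡ L →
  density H A B ≡ bil (edge H) A B * inv L
density-inv H A B {L} 0<L |A| |B| = trans (cong₂ (λ a b → frac (e H A B) (a ℕ.* b)) |A| |B|)
  (trans (frac-inv (e H A B) 0<L) (cong (_* inv L) (⟦e⟧ H A B)))

density-* : ∀ {n} (H : Graph n) (A B : Subset n) → 0 ℕ.< card A → 0 ℕ.< card B →
  density H A B * (⟦ card A ⟧ * ⟦ card B ⟧) ≡ bil (edge H) A B
density-* H A B 0<A 0<B = trans (cong (density H A B *_) (sym (⟦⟧-* (card A) (card B))))
  (trans (frac-* (e H A B) (card A ℕ.* card B) (ℕ.*-mono-≤ 0<A 0<B)) (⟦e⟧ H A B))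

-- Once `X` has been shrunk, exchanging the summations turns the same argument on `Y`.
shrink-pair : ∀ {n} m (X Y : Subset n) w → m ℕ.≤ card X → m ℕ.≤ card Y → 0ℚ ≤ bil w X Y →
  ∃[ X′ ] ∃[ Y′ ] X′ ⊆ X × Y′ ⊆ Y × card X′ ≡ m × card Y′ ≡ m × 0ℚ ≤ bil w X′ Y′
shrink-pair m X Y w m≤X m≤Y 0≤w =
  let X′ , X′⊆X , |X′| , 0≤w′ = shrink m X (λ u → ∑∈ Y (w u)) m≤X 0≤w
      Y′ , Y′⊆Y , |Y′| , 0≤w″ = shrink m Y (λ v → ∑∈ X′ (λ u → w u v)) m≤Y (subst (0ℚ ≤_) (bil-comm X′ Y w) 0≤w′)
  in X′ , Y′ , X′⊆X , Y′⊆Y , |X′| , |Y′| , subst (0ℚ ≤_) (sym (bil-comm X′ Y′ w)) 0≤w″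

bil-affine : ∀ {n} (A B : Subset n) σ c (w : Fin n → Fin n → ℚ) →
  bil (λ u v → σ * w u v + c) A B ≡ σ * bil w A B + ⟦ card A ⟧ * ⟦ card B ⟧ * c
bil-affine A B σ c w = trans (bil-+ A B (λ u v → σ * w u v) (λ _ _ → c)) (cong₂ _+_ (bil-* A B σ w) (bil-const A B c))

record Cylinder (n k L : ℕ) : Set where
  field
    side     : Fin k → Subset n
    size     : ∀ i → card (side i) ≡ L
    disjoint : ∀ i j → ¬ (i ≡ j) → Disjoint (side i) (side j)
open Cylinder

module _ {n} (H : Graph n) (ε : ℚ) where
  -- Squared, so that deviations of either sign are treated alike; the right side is one term of the
  -- variance.
  Deviates : (m : ℕ) → ℚ → Subset n → Subset n → Set
  Deviates m d X Y = ε * ε ≤ (bil (edge H) X Y * inv m - d) * (bil (edge H) X Y * inv m - d)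

  -- X and then Y are shrunk by discarding vertices of least σ-weighted degree.
  deviation-shrinks : ∀ {m} {X Y : Subset n} d σ → 0ℚ ≤ ε → σ * σ ≡ 1ℚ → 0 ℕ.< m → m ℕ.≤ card X → m ℕ.≤ card Y →
    ε ≤ σ * (density H X Y - d) →
    ∃[ X′ ] ∃[ Y′ ] X′ ⊆ X × Y′ ⊆ Y × card X′ ≡ m × card Y′ ≡ m × Deviates m d X′ Y′
  deviation-shrinks {m} {X} {Y} d σ 0≤ε σσ≡1 0<m m≤X m≤Y dev =
    let X′ , Y′ , X′⊆X , Y′⊆Y , |X′| , |Y′| , 0≤w′ = shrink-pair m X Y w m≤X m≤Y 0≤w
    in X′ , Y′ , X′⊆X , Y′⊆Y , |X′| , |Y′| , conclude X′ Y′ |X′| |Y′| 0≤w′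
    where
    open ≤-Reasoning
    -- With this constant, nonnegativity of the total weight `bil w X Y` says precisely that σ times
    -- the deviation of the density from `d` is at least ε.
    c = - (σ * d + ε)
    w : Fin n → Fin n → ℚ
    w u v = σ * edge H u v + c
    x = ⟦ card X ⟧
    y = ⟦ card Y ⟧
    0≤w : 0ℚ ≤ bil w X Y
    0≤w = subst (0ℚ ≤_) eq (*-nonneg (≤⇒0≤- dev) (*-nonneg (⟦⟧-nonneg (card X)) (⟦⟧-nonneg (card Y))))
      where
      eq : (σ * (density H X Y - d) - ε) * (x * y) ≡ bil w X Y
      eq = begin-equality
        (σ * (density H X Y - d) - ε) * (x * y)
          ≡⟨ solve 5 (λ σ D d ε z → (σ :* (D :- d) :- ε) :* z := σ :* (D :* z) :+ z :* (:- (σ :* d :+ ε))) refl σ (density H X Y) d ε (x * y) ⟩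
        σ * (density H X Y * (x * y)) + x * y * c
          ≡⟨ cong (λ z → σ * z + x * y * c) (density-* H X Y (ℕ.≤-trans 0<m m≤X) (ℕ.≤-trans 0<m m≤Y)) ⟩
        σ * bil (edge H) X Y + x * y * c ≡⟨ bil-affine X Y σ c (edge H) ⟨
        bil w X Y ∎
    conclude : ∀ X′ Y′ → card X′ ≡ m → card Y′ ≡ m → 0ℚ ≤ bil w X′ Y′ → Deviates m d X′ Y′
    conclude X′ Y′ |X′| |Y′| 0≤w′ = begin
      ε * ε                             ≤⟨ square-mono 0≤ε ε≤ ⟩
      σ * (D - d) * (σ * (D - d))       ≡⟨ solve 2 (λ σ z → σ :* z :* (σ :* z) := σ :* σ :* (z :* z)) refl σ (D - d) ⟩
      σ * σ * ((D - d) * (D - d))       ≡⟨ cong (_* ((D - d) * (D - d))) σσ≡1 ⟩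
      1ℚ * ((D - d) * (D - d))          ≡⟨ *-identityˡ _ ⟩
      (D - d) * (D - d)                 ∎
      where
      M = ⟦ m ⟧
      b = bil (edge H) X′ Y′
      D = b * inv m
      0≤′ : 0ℚ ≤ (σ * b + M * M * c) * inv m
      0≤′ = *-nonneg (subst (0ℚ ≤_) (trans (bil-affine X′ Y′ σ c (edge H))
        (cong₂ (λ i j → σ * b + ⟦ i ⟧ * ⟦ j ⟧ * c) |X′| |Y′|)) 0≤w′) (inv-nonneg 0<m)
      ε≤ : ε ≤ σ * (D - d)
      ε≤ = ≤-by ((σ * b + M * M * c) * inv m) 0≤′ (begin-equality
        -- The factor 1 in front of `c` is kept visible so that it can be replaced by
        -- `inv m * (M * M)` in the next step.
        σ * (D - d)  ≡⟨ solve 4 (λ σ D d ε → σ :* (D :- d) := ε :+ (σ :* D :+ con 1ℚ :* (:- (σ :* d :+ ε)))) refl σ D d ε ⟩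
        ε + (σ * D + 1ℚ * c) ≡⟨ cong (λ z → ε + (σ * D + z * c)) (inv-* 0<m) ⟨
        ε + (σ * D + inv m * (M * M) * c)
          ≡⟨ cong (_+_ ε) (solve 5 (λ σ b i M c → σ :* (b :* i) :+ i :* (M :* M) :* c := (σ :* b :+ M :* M :* c) :* i) refl σ b (inv m) M c) ⟩
        ε + (σ * b + M * M * c) * inv m ∎)

  -- The failure of regularity in existential form: it is decidable by searching all pairs of
  -- subsets, and a positive answer delivers the witnesses.
  Irregular : Subset n → Subset n → Set
  Irregular A B = ∃[ X ] ∃[ Y ] X ⊆ A × Y ⊆ B × ε * ℕ→ℚ (card A) < ℕ→ℚ (card X) × ε * ℕ→ℚ (card B) < ℕ→ℚ (card Y) ×
    ε ≤ ∣ density H X Y - density H A B ∣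

  irregular? : ∀ A B → Dec (Irregular A B)
  irregular? A B = anySubset? λ X → anySubset? λ Y → X ⊆? A ×-dec Y ⊆? B ×-dec (ε * ℕ→ℚ (card A) <? ℕ→ℚ (card X)) ×-dec
    (ε * ℕ→ℚ (card B) <? ℕ→ℚ (card Y)) ×-dec (ε ≤? ∣ density H X Y - density H A B ∣)

  ¬irregular⇒regular : ∀ A B → ¬ Irregular A B → IsRegular ε H A B
  ¬irregular⇒regular A B ¬irr X Y X⊆A Y⊆B X> Y> = ≰⇒> λ ε≤ → ¬irr (X , Y , X⊆A , Y⊆B , X> , Y> , ε≤)

  -- By 1 ≤ (q + 1) ε, a subset larger than ε (q + 1) m has at least m elements, so each witness can
  -- be cut down to the size of exactly one block.
  irregular⇒deviation : ∀ {q m} {A B : Subset n} → 0ℚ ≤ ε → 1ℚ ≤ ⟦ suc q ⟧ * ε → 0 ℕ.< m →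
    card A ≡ suc q ℕ.* m → card B ≡ suc q ℕ.* m → Irregular A B →
    ∃[ X′ ] ∃[ Y′ ] X′ ⊆ A × Y′ ⊆ B × card X′ ≡ m × card Y′ ≡ m × Deviates m (bil (edge H) A B * inv (suc q ℕ.* m)) X′ Y′
  irregular⇒deviation {q} {m} {A} {B} 0≤ε 1≤Qε 0<m |A| |B| (X , Y , X⊆A , Y⊆B , X> , Y> , dev) =
    let X′ , Y′ , X′⊆X , Y′⊆Y , rest = shrunk (∣p∣≡p∨∣p∣≡-p (density H X Y - density H A B))
    in X′ , Y′ , ⊆-trans X′⊆X X⊆A , ⊆-trans Y′⊆Y Y⊆B , rest
    where
    open ≤-Reasoning
    d = bil (edge H) A B * inv (suc q ℕ.* m)
    dAB : density H A B ≡ d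
    dAB = density-inv H A B (ℕ.≤-trans 0<m (ℕ.m≤m+n m (q ℕ.* m))) |A| |B|
    large : ∀ {A X : Subset n} → card A ≡ suc q ℕ.* m → ε * ℕ→ℚ (card A) < ℕ→ℚ (card X) → m ℕ.≤ card X
    large {A} {X} |A| X> = ⟦⟧-cancel-≤ (begin
      ⟦ m ⟧                    ≡⟨ *-identityˡ _ ⟨
      1ℚ * ⟦ m ⟧               ≤⟨ *-mono-≤ʳ (⟦⟧-nonneg m) 1≤Qε ⟩
      ⟦ suc q ⟧ * ε * ⟦ m ⟧    ≡⟨ solve 3 (λ Q ε m → Q :* ε :* m := ε :* (Q :* m)) refl ⟦ suc q ⟧ ε ⟦ m ⟧ ⟩
      ε * (⟦ suc q ⟧ * ⟦ m ⟧)  ≡⟨ cong (ε *_) (⟦⟧-* (suc q) m) ⟨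
      ε * ⟦ suc q ℕ.* m ⟧      ≡⟨ cong (λ z → ε * ⟦ z ⟧) |A| ⟨
      ε * ⟦ card A ⟧           ≤⟨ <⇒≤ (subst₂ (λ a x → ε * a < x) (sym (⟦⟧-def (card A))) (sym (⟦⟧-def (card X))) X>) ⟩
      ⟦ card X ⟧               ∎)
    shrunk : ∣ density H X Y - density H A B ∣ ≡ density H X Y - density H A B
           ⊎ ∣ density H X Y - density H A B ∣ ≡ - (density H X Y - density H A B) →
      ∃[ X′ ] ∃[ Y′ ] X′ ⊆ X × Y′ ⊆ Y × card X′ ≡ m × card Y′ ≡ m × Deviates m d X′ Y′
    shrunk (inj₁ eq) = deviation-shrinks d 1ℚ 0≤ε refl 0<m (large {A} {X} |A| X>) (large {B} {Y} |B| Y>)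
      (≤-trans dev (≤-reflexive (trans eq (trans (cong (λ z → density H X Y - z) dAB) (sym (*-identityˡ _))))))
    shrunk (inj₂ eq) = deviation-shrinks d (- 1ℚ) 0≤ε refl 0<m (large {A} {X} |A| X>) (large {B} {Y} |B| Y>)
      (≤-trans dev (≤-reflexive (trans eq (trans (cong (λ z → - (density H X Y - z)) dAB)
        (solve 1 (λ z → :- z := con (- 1ℚ) :* z) refl (density H X Y - d))))))

  AllRegular : ∀ {k L} → Cylinder n k L → Set
  AllRegular W = ∀ i j → ¬ (i ≡ j) → IsRegular ε H (side W i) (side W j)

  regular-or-irregular : ∀ {k L} (W : Cylinder n k L) →
    AllRegular W ⊎ (∃[ a ] ∃[ b ] ¬ (a ≡ b) × Irregular (side W a) (side W b))
  regular-or-irregular W = decide (any? λ a → any? λ b → ¬? (a Finₚ.≟ b) ×-dec irregular? (side W a) (side W b))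
    where
    decide : Dec (∃[ a ] ∃[ b ] ¬ (a ≡ b) × Irregular (side W a) (side W b)) →
      AllRegular W ⊎ (∃[ a ] ∃[ b ] ¬ (a ≡ b) × Irregular (side W a) (side W b))
    decide (yes irr) = inj₂ irr
    decide (no none) = inj₁ λ i j i≢j → ¬irregular⇒regular (side W i) (side W j) λ irr → none (i , j , i≢j , irr)

-- The potential and its decrease

sum₂ : ∀ {p q} → (Fin p → Fin q → ℚ) → ℚ
sum₂ f = sum λ x → sum (f x)

sum₂-linear : ∀ {p q} c (f g : Fin p → Fin q → ℚ) → sum₂ (λ x y → f x y + c * g x y) ≡ sum₂ f + c * sum₂ g
sum₂-linear c f g = trans
  (sum-cong λ x → trans (sum-+ (f x) (λ y → c * g x y)) (cong (_+_ (sum (f x))) (sum-*ˡ c (g x))))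
  (trans (sum-+ (λ x → sum (f x)) (λ x → c * sum (g x))) (cong (_+_ (sum₂ f)) (sum-*ˡ c (λ x → sum (g x)))))

sum₂-*ʳ : ∀ {p q} c (f : Fin p → Fin q → ℚ) → sum₂ (λ x y → f x y * c) ≡ sum₂ f * c
sum₂-*ʳ c f = trans (sum-cong λ x → sum-*ʳ c (f x)) (sum-*ʳ c (λ x → sum (f x)))

-- From 1/m² = q²/(q m)²: the normalised weight of a pair is the mean of those of its block pairs.
-- Applied to the edits it shows that averaging leaves them unchanged; applied to the edges it
-- supplies the mean for `variance`.
bil-mean : ∀ {n q m} {A B : Subset n} (𝓐 : Blocks (q) m A) (𝓑 : Blocks (q) m B) → 0 ℕ.< q → 0 ℕ.< m → ∀ w →
  sum₂ (λ x y → bil w (part 𝓐 x) (part 𝓑 y) * inv m) ≡ ⟦ q ⟧ * ⟦ q ⟧ * (bil w A B * inv (q ℕ.* m))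
bil-mean {q = q} {m} {A} {B} 𝓐 𝓑 0<q 0<m w = begin-equality
  sum₂ (λ x y → bil w (part 𝓐 x) (part 𝓑 y) * inv m)   ≡⟨ sum₂-*ʳ (inv m) (λ x y → bil w (part 𝓐 x) (part 𝓑 y)) ⟩
  sum₂ (λ x y → bil w (part 𝓐 x) (part 𝓑 y)) * inv m   ≡⟨ cong₂ _*_ (sym (bil-blocks 𝓐 𝓑 w)) (inv-scale q m 0<q 0<m) ⟩
  bil w A B * (Q * Q * inv (q ℕ.* m))              ≡⟨ solve 3 (λ b Q i → b :* (Q :* i) := Q :* (b :* i)) refl (bil w A B) (Q * Q) (inv (q ℕ.* m)) ⟩
  Q * Q * (bil w A B * inv (q ℕ.* m))              ∎
  where
  open ≤-Reasoning
  Q = ⟦ q ⟧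

module _ {n} (H : Graph n) (ε : ℚ) (Δ : Fin n → Fin n → ℚ) where
  d⟨_⟩ : ℕ → Subset n → Subset n → ℚ
  d⟨ L ⟩ A B = bil (edge H) A B * inv L

  Δ⟨_⟩ : ℕ → Subset n → Subset n → ℚ
  Δ⟨ L ⟩ A B = bil Δ A B * inv L

  φ : ℕ → Subset n → Subset n → ℚ
  φ L A B = Δ⟨ L ⟩ A B + (- ε) * (d⟨ L ⟩ A B * d⟨ L ⟩ A B)

  Φ : ∀ {k L} → Cylinder n k L → ℚ
  Φ {L = L} W = pairSum λ i j → φ L (side W i) (side W j)

  spread : ∀ {q m A B} → Blocks (q) m A → Blocks (q) m B → ℚ
  spread {q} {m} {A} {B} 𝓐 𝓑 = sum₂ λ x y → (d⟨ m ⟩ (part 𝓐 x) (part 𝓑 y) - d⟨ q ℕ.* m ⟩ A B) *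
                                             (d⟨ m ⟩ (part 𝓐 x) (part 𝓑 y) - d⟨ q ℕ.* m ⟩ A B)

  -- The edit part is linear and is preserved; the energy part is quadratic and gains the variance
  -- `spread`.
  φ-blocks : ∀ {q m A B} (𝓐 : Blocks (q) m A) (𝓑 : Blocks (q) m B) → 0 ℕ.< q → 0 ℕ.< m →
    sum₂ (λ x y → φ m (part 𝓐 x) (part 𝓑 y)) ≡ ⟦ q ⟧ * ⟦ q ⟧ * φ (q ℕ.* m) A B + (- ε) * spread 𝓐 𝓑
  φ-blocks {q} {m} {A} {B} 𝓐 𝓑 0<q 0<m = begin-equality
    sum₂ (λ x y → φ m (part 𝓐 x) (part 𝓑 y))
      ≡⟨ sum₂-linear (- ε) (λ x y → Δ⟨ m ⟩ (part 𝓐 x) (part 𝓑 y)) (λ x y → d x y * d x y) ⟩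
    sum₂ (λ x y → Δ⟨ m ⟩ (part 𝓐 x) (part 𝓑 y)) + (- ε) * sum₂ (λ x y → d x y * d x y)
      ≡⟨ cong₂ (λ a b → a + (- ε) * b) (bil-mean 𝓐 𝓑 0<q 0<m Δ) (variance d μ (bil-mean 𝓐 𝓑 0<q 0<m (edge H))) ⟩
    Q * Q * D + (- ε) * (Q * Q * (μ * μ) + spread 𝓐 𝓑)
      ≡⟨ solve 5 (λ Q D ε μ V → Q :* D :+ ε :* (Q :* μ :+ V) := Q :* (D :+ ε :* μ) :+ ε :* V) refl (Q * Q) D (- ε) (μ * μ) (spread 𝓐 𝓑) ⟩
    Q * Q * φ (q ℕ.* m) A B + (- ε) * spread 𝓐 𝓑 ∎
    where
    open ≤-Reasoning
    Q = ⟦ q ⟧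
    D = Δ⟨ q ℕ.* m ⟩ A B
    μ = d⟨ q ℕ.* m ⟩ A B
    d : Fin (q) → Fin (q) → ℚ
    d x y = d⟨ m ⟩ (part 𝓐 x) (part 𝓑 y)

  spread-nonneg : ∀ {q m A B} (𝓐 : Blocks (q) m A) (𝓑 : Blocks (q) m B) → 0ℚ ≤ spread 𝓐 𝓑
  spread-nonneg {q} {m} {A} {B} 𝓐 𝓑 = sum-nonneg λ x → sum-nonneg λ y → square-nonneg (d⟨ m ⟩ (part 𝓐 x) (part 𝓑 y) - d⟨ q ℕ.* m ⟩ A B)

  spread-deviates : ∀ {q m A B} (𝓐 : Blocks (suc q) m A) (𝓑 : Blocks (suc q) m B) →
    Deviates H ε m (d⟨ suc q ℕ.* m ⟩ A B) (part 𝓐 zero) (part 𝓑 zero) → ε * ε ≤ spread 𝓐 𝓑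
  spread-deviates {q} {m} {A} {B} 𝓐 𝓑 dev = ≤-trans dev (≤-trans
    (term≤sum (λ y → square-nonneg (dev₂ zero y)) zero) (term≤sum (λ x → sum-nonneg λ y → square-nonneg (dev₂ x y)) zero))
    where
    dev₂ : Fin (suc q) → Fin (suc q) → ℚ
    dev₂ x y = d⟨ m ⟩ (part 𝓐 x) (part 𝓑 y) - d⟨ suc q ℕ.* m ⟩ A B

  -- The best choice of blocks is no worse than the mean, in which no pair loses energy and the pair
  -- (a, b) gains at least ε². Only one of its (q + 1)² block pairs is known to deviate, which is
  -- why the drop ε³ is that of (q + 1)² Φ and not of Φ.
  refine : ∀ {k q m} (W : Cylinder n k (suc q ℕ.* m)) → 0ℚ ≤ ε → 0 ℕ.< m → (𝓑 : ∀ i → Blocks (suc q) m (side W i)) →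
    ∀ {a b} → ¬ (a ≡ b) →
    Deviates H ε m (d⟨ suc q ℕ.* m ⟩ (side W a) (side W b)) (part (𝓑 a) zero) (part (𝓑 b) zero) →
    ∃[ W′ ] ⟦ suc q ⟧ * ⟦ suc q ⟧ * Φ {k} {m} W′ + ε * (ε * ε) ≤ ⟦ suc q ⟧ * ⟦ suc q ⟧ * Φ W
  refine {k} {q} {m} W 0≤ε 0<m 𝓑 {a} {b} a≢b dev = W′ , (begin
    QQ * Φ W′ + ε * (ε * ε)
      ≤⟨ +-mono-≤ (proj₂ best) (*-mono-≤ˡ 0≤ε (≤-trans (spread-deviates (𝓑 a) (𝓑 b) dev)
           (term≤pairSum V (λ i j → spread-nonneg (𝓑 i) (𝓑 j)) a b a≢b))) ⟩
    pairSum (λ i j → sum₂ (λ x y → φ m (part (𝓑 i) x) (part (𝓑 j) y))) + ε * pairSum V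
      ≤⟨ +-monoˡ-≤ (ε * pairSum V) (pairSum-mono (λ i j _ → ≤-reflexive (φ-blocks (𝓑 i) (𝓑 j) ℕ.z<s 0<m))) ⟩
    pairSum (λ i j → QQ * φ (suc q ℕ.* m) (side W i) (side W j) + (- ε) * V i j) + ε * pairSum V
      ≡⟨ cong (_+ ε * pairSum V) (trans (pairSum-+ (λ i j → QQ * φ (suc q ℕ.* m) (side W i) (side W j)) (λ i j → (- ε) * V i j))
           (cong₂ _+_ (pairSum-* QQ (λ i j → φ (suc q ℕ.* m) (side W i) (side W j))) (pairSum-* (- ε) V))) ⟩
    QQ * Φ W + (- ε) * pairSum V + ε * pairSum V
      ≡⟨ solve 3 (λ x ε v → x :+ (:- ε) :* v :+ ε :* v := x) refl (QQ * Φ W) ε (pairSum V) ⟩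
    QQ * Φ W ∎)
    where
    open ≤-Reasoning
    QQ = ⟦ suc q ⟧ * ⟦ suc q ⟧
    V : Fin k → Fin k → ℚ
    V i j = spread (𝓑 i) (𝓑 j)
    best = averaging-pairs λ i j x y → φ m (part (𝓑 i) x) (part (𝓑 j) y)
    β = proj₁ best
    W′ : Cylinder n k m
    W′ = record
      { side = λ i → part (𝓑 i) (β i)
      ; size = λ i → size (𝓑 i) (β i)
      ; disjoint = λ i j i≢j u (u∈i , u∈j) → disjoint W i j i≢j u (sub (𝓑 i) (β i) u∈i , sub (𝓑 j) (β j) u∈j) }

  irregular⇒refine : ∀ {k q m} (W : Cylinder n k (suc q ℕ.* m)) → 0ℚ ≤ ε → 1ℚ ≤ ⟦ suc q ⟧ * ε → 0 ℕ.< m →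
    ∀ {a b} → ¬ (a ≡ b) → Irregular H ε (side W a) (side W b) →
    ∃[ W′ ] ⟦ suc q ⟧ * ⟦ suc q ⟧ * Φ {k} {m} W′ + ε * (ε * ε) ≤ ⟦ suc q ⟧ * ⟦ suc q ⟧ * Φ W
  irregular⇒refine {k} {q} {m} W 0≤ε 1≤Qε 0<m {a} {b} a≢b irr =
    let X , Y , X⊆ , Y⊆ , |X| , |Y| , dev =
          irregular⇒deviation H ε {q} {m} {side W a} {side W b} 0≤ε 1≤Qε 0<m (size W a) (size W b) irr
    in refine′ X Y X⊆ Y⊆ |X| |Y| dev
    where
    refine′ : ∀ X Y → X ⊆ side W a → Y ⊆ side W b → card X ≡ m → card Y ≡ m →
      Deviates H ε m (d⟨ suc q ℕ.* m ⟩ (side W a) (side W b)) X Y →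
      ∃[ W′ ] ⟦ suc q ⟧ * ⟦ suc q ⟧ * Φ {k} {m} W′ + ε * (ε * ε) ≤ ⟦ suc q ⟧ * ⟦ suc q ⟧ * Φ W
    refine′ X Y X⊆ Y⊆ |X| |Y| dev = refine W 0≤ε 0<m 𝓑 a≢b
      (subst₂ (Deviates H ε m (d⟨ suc q ℕ.* m ⟩ (side W a) (side W b)))
        (sym (pick-a (a Finₚ.≟ a) (a Finₚ.≟ b))) (sym (pick-b (b Finₚ.≟ a) (b Finₚ.≟ b))) dev)
      where
      -- The two decisions are arguments, so that `pick-a` and `pick-b` can be proved by splitting
      -- on them.
      pick : ∀ i → Dec (i ≡ a) → Dec (i ≡ b) → Blocks (suc q) m (side W i)
      pick i (yes refl) _ = proj₁ (blocks-from q m (side W i) X (size W i) X⊆ |X|)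
      pick i (no _) (yes refl) = proj₁ (blocks-from q m (side W i) Y (size W i) Y⊆ |Y|)
      pick i (no _) (no _) = blocks (suc q) m (side W i) (size W i)
      pick-a : ∀ a≟a a≟b → part (pick a a≟a a≟b) zero ≡ X
      pick-a (yes refl) _ = refl
      pick-a (no a≢a) _ = contradiction refl a≢a
      pick-b : ∀ b≟a b≟b → part (pick b b≟a b≟b) zero ≡ Y
      pick-b (yes b≡a) _ = contradiction (sym b≡a) a≢b
      pick-b (no _) (yes refl) = refl
      pick-b (no _) (no b≢b) = contradiction refl b≢b
      𝓑 : ∀ i → Blocks (suc q) m (side W i)
      𝓑 i = pick i (i Finₚ.≟ a) (i Finₚ.≟ b)

-- Bounds on the potential, and the iteration

normalised-nonneg : ∀ {n L} {A B : Subset n} {w} → 0 ℕ.< L → (∀ u v → 0ℚ ≤ w u v) → 0ℚ ≤ bil w A B * inv L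
normalised-nonneg {A = A} {B} 0<L 0≤w = *-nonneg (∑∈-nonneg A λ {u} _ → ∑∈-nonneg B λ {v} _ → 0≤w u v) (inv-nonneg 0<L)

normalised≤1 : ∀ {n L} {A B : Subset n} {w} → 0 ℕ.< L → card A ≡ L → card B ≡ L → (∀ u v → w u v ≤ 1ℚ) → bil w A B * inv L ≤ 1ℚ
normalised≤1 {L = L} {A} {B} {w} 0<L |A| |B| w≤1 = begin
  bil w A B * inv L                         ≤⟨ *-mono-≤ʳ (inv-nonneg 0<L) (bil-mono A B w≤1) ⟩
  bil (λ _ _ → 1ℚ) A B * inv L              ≡⟨ cong (_* inv L) (bil-const A B 1ℚ) ⟩
  ⟦ card A ⟧ * ⟦ card B ⟧ * 1ℚ * inv L      ≡⟨ cong₂ (λ a b → ⟦ a ⟧ * ⟦ b ⟧ * 1ℚ * inv L) |A| |B| ⟩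
  ⟦ L ⟧ * ⟦ L ⟧ * 1ℚ * inv L                ≡⟨ solve 2 (λ x i → x :* con 1ℚ :* i := i :* x) refl (⟦ L ⟧ * ⟦ L ⟧) (inv L) ⟩
  inv L * (⟦ L ⟧ * ⟦ L ⟧)                   ≡⟨ inv-* 0<L ⟩
  1ℚ                                        ∎
  where open ≤-Reasoning

pairSum≤square : ∀ k → pairSum {k} (λ _ _ → 1ℚ) ≤ ⟦ k ⟧ * ⟦ k ⟧
pairSum≤square k = begin
  pairSum {k} (λ _ _ → 1ℚ)                                ≤⟨ ≤-addˡ _ (sum-nonneg {k} λ _ → nonNegative⁻¹ 1ℚ) ⟩
  sum {k} (λ _ → 1ℚ) + pairSum {k} (λ _ _ → 1ℚ)           ≡⟨ pairSum-diagonal {k} (λ _ _ → 1ℚ) ⟨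
  sum {k} (λ _ → sum {k} (λ _ → 1ℚ))                      ≡⟨ trans (sum-const k (sum {k} (λ _ → 1ℚ))) (cong (⟦ k ⟧ *_) (trans (sum-const k 1ℚ) (*-identityʳ ⟦ k ⟧))) ⟩
  ⟦ k ⟧ * ⟦ k ⟧                                           ∎
  where open ≤-Reasoning

-- m (q + 1)^t: a set of this size can be cut t times and still has m elements, so t serves as the
-- fuel of `regularise`.
scale : ℕ → ℕ → ℕ → ℕ
scale q m zero = m
scale q m (suc t) = suc q ℕ.* scale q m t

m≤scale : ∀ q m t → m ℕ.≤ scale q m t
m≤scale q m zero = ℕ.≤-refl
m≤scale q m (suc t) = ℕ.≤-trans (m≤scale q m t) (ℕ.m≤m+n (scale q m t) (q ℕ.* scale q m t))

module _ {n} (H : Graph n) (ε : ℚ) (Δ : Fin n → Fin n → ℚ) (0≤ε : 0ℚ ≤ ε) (0≤Δ : ∀ u v → 0ℚ ≤ Δ u v) where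
  ∑Δ : ∀ {k L} → Cylinder n k L → ℚ
  ∑Δ {L = L} W = pairSum λ i j → bil Δ (side W i) (side W j) * inv L

  Φ≤∑Δ : ∀ {k L} (W : Cylinder n k L) → Φ H ε Δ W ≤ ∑Δ W
  Φ≤∑Δ {L = L} W = pairSum-mono λ i j _ → ≤-by (ε * (d i j * d i j)) (*-nonneg 0≤ε (square-nonneg (d i j)))
    (solve 3 (λ D ε x → D := D :+ (:- ε) :* x :+ ε :* x) refl (bil Δ (side W i) (side W j) * inv L) ε (d i j * d i j))
    where
    d : _ → _ → ℚ
    d i j = bil (edge H) (side W i) (side W j) * inv L

  -- Densities lie in [0, 1], so each pair hides at most ε in its energy. Together with `Φ≤∑Δ` this
  -- converts a decrease of the potential into a growth of the edit sum by at most ε k².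
  ∑Δ≤Φ : ∀ {k L} → 0 ℕ.< L → (W : Cylinder n k L) → ∑Δ W ≤ Φ H ε Δ W + ε * (⟦ k ⟧ * ⟦ k ⟧)
  ∑Δ≤Φ {k} {L} 0<L W = begin
    ∑Δ W
      ≤⟨ pairSum-mono (λ i j _ → ≤-by (ε * (1ℚ - d i j * d i j)) (*-nonneg 0≤ε (≤⇒0≤- (d²≤1 i j)))
           (solve 3 (λ D ε x → D :+ (:- ε) :* x :+ ε :* con 1ℚ := D :+ ε :* (con 1ℚ :- x)) refl
             (bil Δ (side W i) (side W j) * inv L) ε (d i j * d i j))) ⟩
    pairSum (λ i j → φ H ε Δ L (side W i) (side W j) + ε * 1ℚ)
      ≡⟨ trans (pairSum-+ (λ i j → φ H ε Δ L (side W i) (side W j)) (λ _ _ → ε * 1ℚ))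
           (cong (_+_ (Φ H ε Δ W)) (pairSum-* {k} ε (λ _ _ → 1ℚ))) ⟩
    Φ H ε Δ W + ε * pairSum {k} (λ _ _ → 1ℚ)
      ≤⟨ +-monoʳ-≤ (Φ H ε Δ W) (*-mono-≤ˡ 0≤ε (pairSum≤square k)) ⟩
    Φ H ε Δ W + ε * (⟦ k ⟧ * ⟦ k ⟧) ∎
    where
    open ≤-Reasoning
    d : Fin k → Fin k → ℚ
    d i j = bil (edge H) (side W i) (side W j) * inv L
    d²≤1 : ∀ i j → d i j * d i j ≤ 1ℚ
    d²≤1 i j = square-mono {q = 1ℚ} (normalised-nonneg {A = side W i} {side W j} 0<L (λ u v → ind-nonneg (adj H u v)))
      (normalised≤1 {A = side W i} {side W j} 0<L (size W i) (size W j) (λ u v → ind≤1 (adj H u v)))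

  ∑Δ-nonneg : ∀ {k L} → 0 ℕ.< L → (W : Cylinder n k L) → 0ℚ ≤ ∑Δ W
  ∑Δ-nonneg 0<L W = pairSum-nonneg _ λ i j → normalised-nonneg {A = side W i} {side W j} 0<L 0≤Δ

  -- Each refinement lowers q²Φ by ε³, and Φ ≥ - ε k².
  regularise : ∀ {k q m} t → 1ℚ ≤ ⟦ suc q ⟧ * ε → 0 ℕ.< m → (W : Cylinder n k (scale q m t)) →
    ⟦ suc q ⟧ * ⟦ suc q ⟧ * (Φ H ε Δ W + ε * (⟦ k ⟧ * ⟦ k ⟧)) < ⟦ t ⟧ * (ε * (ε * ε)) →
    ∃[ L ] m ℕ.≤ L × Σ (Cylinder n k L) λ W′ → Φ H ε Δ W′ ≤ Φ H ε Δ W × AllRegular H ε W′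
  -- Without fuel, `small` would place a nonnegative number strictly below 0.
  regularise {k} {q} {m} zero 1≤Qε 0<m W small = contradiction (<-≤-trans small (≤-trans (≤-reflexive zero*) nonneg)) (<-irrefl refl)
    where
    zero* : ⟦ 0 ⟧ * (ε * (ε * ε)) ≡ 0ℚ
    zero* = trans (cong (_* (ε * (ε * ε))) ⟦⟧-0) (*-zeroˡ (ε * (ε * ε)))
    nonneg : 0ℚ ≤ ⟦ suc q ⟧ * ⟦ suc q ⟧ * (Φ H ε Δ W + ε * (⟦ k ⟧ * ⟦ k ⟧))
    nonneg = *-nonneg (square-nonneg ⟦ suc q ⟧) (≤-trans (∑Δ-nonneg 0<m W) (∑Δ≤Φ 0<m W))
  regularise {k} {q} {m} (suc t) 1≤Qε 0<m W small = continue (regular-or-irregular H ε W)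
    where
    open ≤-Reasoning
    QQ = ⟦ suc q ⟧ * ⟦ suc q ⟧
    K² = ⟦ k ⟧ * ⟦ k ⟧
    ε³ = ε * (ε * ε)
    0<QQ : 0ℚ < QQ
    0<QQ = *-pos 0<Q 0<Q
      where
      0<Q : 0ℚ < ⟦ suc q ⟧
      0<Q = subst (_< ⟦ suc q ⟧) ⟦⟧-0 (⟦⟧-< (ℕ.z<s {q}))
    0≤ε³ : 0ℚ ≤ ε³
    0≤ε³ = *-nonneg 0≤ε (square-nonneg ε)
    Result : Set
    Result = ∃[ L ] m ℕ.≤ L × Σ (Cylinder n k L) λ W′ → Φ H ε Δ W′ ≤ Φ H ε Δ W × AllRegular H ε W′
    descend : (W₁ : Cylinder n k (scale q m t)) → QQ * Φ H ε Δ W₁ + ε³ ≤ QQ * Φ H ε Δ W → Result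
    descend W₁ drop =
      let L , m≤L , W′ , Φ≤ , reg = regularise {k} {q} {m} t 1≤Qε 0<m W₁ small₁ in L , m≤L , W′ , ≤-trans Φ≤ Φ₁≤ , reg
      where
      Φ₁ = Φ H ε Δ W₁
      Φ₀ = Φ H ε Δ W
      Φ₁≤ : Φ₁ ≤ Φ₀
      Φ₁≤ = *-cancel-≤ˡ 0<QQ (≤-trans (≤-addʳ (QQ * Φ₁) 0≤ε³) drop)
      -- The drop by ε³ pays for exactly one unit of fuel.
      small₁ : QQ * (Φ₁ + ε * K²) < ⟦ t ⟧ * ε³
      small₁ = begin-strict
        QQ * (Φ₁ + ε * K²)               ≡⟨ solve 4 (λ Q p e x → Q :* (p :+ e) := Q :* p :+ x :+ (Q :* e :- x)) refl QQ Φ₁ (ε * K²) ε³ ⟩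
        QQ * Φ₁ + ε³ + (QQ * (ε * K²) - ε³) ≤⟨ +-monoˡ-≤ (QQ * (ε * K²) - ε³) drop ⟩
        QQ * Φ₀ + (QQ * (ε * K²) - ε³)   ≡⟨ solve 4 (λ Q p e x → Q :* p :+ (Q :* e :- x) := Q :* (p :+ e) :- x) refl QQ Φ₀ (ε * K²) ε³ ⟩
        QQ * (Φ₀ + ε * K²) - ε³          <⟨ +-monoˡ-< (- ε³) small ⟩
        ⟦ suc t ⟧ * ε³ - ε³              ≡⟨ cong (λ z → z * ε³ - ε³) (⟦⟧-suc t) ⟩
        (1ℚ + ⟦ t ⟧) * ε³ - ε³           ≡⟨ solve 2 (λ t x → (con 1ℚ :+ t) :* x :- x := t :* x) refl ⟦ t ⟧ ε³ ⟩
        ⟦ t ⟧ * ε³                       ∎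
    continue : AllRegular H ε W ⊎ (∃[ a ] ∃[ b ] ¬ (a ≡ b) × Irregular H ε (side W a) (side W b)) → Result
    continue (inj₁ reg) = scale q m (suc t) , m≤scale q m (suc t) , W , ≤-refl , reg
    continue (inj₂ (a , b , a≢b , irr)) =
      let W₁ , drop = irregular⇒refine H ε Δ {k} {q} {scale q m t} W 0≤ε 1≤Qε (ℕ.≤-trans 0<m (m≤scale q m t)) a≢b irr
      in descend W₁ drop

-- Sylvester's Hadamard matrices

sign : Bool → ℚ
sign b = if b then - 1ℚ else 1ℚ

sign-not : ∀ b → sign (not b) ≡ - sign b
sign-not true = refl
sign-not false = refl

-- `bound` says that the squared operator norm is at most `C`. In contrast to orthogonality of the
-- rows, this form passes to principal submatrices.
record SignMatrix (n : ℕ) (C : ℚ) : Set where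
  field
    minus       : Fin n → Fin n → Bool
    symmetric : ∀ u v → minus u v ≡ minus v u
    bound     : ∀ (x : Fin n → ℚ) → sum (λ u → sum (λ v → sign (minus u v) * x v) * sum (λ v → sign (minus u v) * x v)) ≤ C * sum (λ v → x v * x v)
open SignMatrix

pow2 : ℕ → ℕ
pow2 zero = 1
pow2 (suc K) = pow2 K ℕ.+ pow2 K

sum-split : ∀ m {n} (f : Fin (m ℕ.+ n) → ℚ) → sum f ≡ sum (λ i → f (i ↑ˡ n)) + sum (λ j → f (m ↑ʳ j))
sum-split zero f = sym (+-identityˡ (sum f))
sum-split (suc m) {n} f = trans (cong (_+_ (f zero)) (sum-split m (f ∘ suc)))
  (sym (+-assoc (f zero) (sum λ i → f (suc (i ↑ˡ n))) (sum λ j → f (suc (m ↑ʳ j)))))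

-- Sylvester's doubling: the block matrix with rows (S, S) and (S, -S).
double : ∀ {n} → (Fin n → Fin n → Bool) → Fin n ⊎ Fin n → Fin n ⊎ Fin n → Bool
double b (inj₁ u) (inj₁ v) = b u v
double b (inj₁ u) (inj₂ v) = b u v
double b (inj₂ u) (inj₁ v) = b u v
double b (inj₂ u) (inj₂ v) = not (b u v)

double-sym : ∀ {n} (b : Fin n → Fin n → Bool) → (∀ u v → b u v ≡ b v u) → ∀ u v → double b u v ≡ double b v u
double-sym b b-sym (inj₁ u) (inj₁ v) = b-sym u v
double-sym b b-sym (inj₁ u) (inj₂ v) = b-sym u v
double-sym b b-sym (inj₂ u) (inj₁ v) = b-sym u v
double-sym b b-sym (inj₂ u) (inj₂ v) = cong not (b-sym u v)

hadamard : ∀ K → SignMatrix (pow2 K) ⟦ pow2 K ⟧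
hadamard zero = record
  { minus = λ _ _ → false
  ; symmetric = λ _ _ → refl
  ; bound = λ x → ≤-reflexive (trans
      (solve 1 (λ a → (con 1ℚ :* a :+ con 0ℚ) :* (con 1ℚ :* a :+ con 0ℚ) :+ con 0ℚ := con 1ℚ :* (a :* a :+ con 0ℚ)) refl (x zero))
      (cong (_* (x zero * x zero + 0ℚ)) (sym ⟦⟧-1))) }
hadamard (suc K) = record
  { minus = minus′
  ; symmetric = λ u v → double-sym (minus S) (symmetric S) (splitAt N u) (splitAt N v)
  ; bound = bound′ }
  where
  N = pow2 K
  S = hadamard K
  minus′ : Fin (N ℕ.+ N) → Fin (N ℕ.+ N) → Bool
  minus′ u v = double (minus S) (splitAt N u) (splitAt N v)
  module _ (x : Fin (N ℕ.+ N) → ℚ) where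
    open ≤-Reasoning
    row : Fin (N ℕ.+ N) → ℚ
    row u = sum λ v → sign (minus′ u v) * x v
    xˡ xʳ p r : Fin N → ℚ
    xˡ v = x (v ↑ˡ N)
    xʳ v = x (N ↑ʳ v)
    p u = sum λ v → sign (minus S u v) * xˡ v
    r u = sum λ v → sign (minus S u v) * xʳ v
    rowˡ : ∀ u → row (u ↑ˡ N) ≡ p u + r u
    rowˡ u = trans (sum-split N (λ v → sign (minus′ (u ↑ˡ N) v) * x v)) (cong₂ _+_
      (sum-cong λ v → cong (λ b → sign b * xˡ v) (cong₂ (double (minus S)) (splitAt-↑ˡ N u N) (splitAt-↑ˡ N v N)))
      (sum-cong λ v → cong (λ b → sign b * xʳ v) (cong₂ (double (minus S)) (splitAt-↑ˡ N u N) (splitAt-↑ʳ N N v))))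
    rowʳ : ∀ u → row (N ↑ʳ u) ≡ p u - r u
    rowʳ u = trans (sum-split N (λ v → sign (minus′ (N ↑ʳ u) v) * x v)) (cong₂ _+_
      (sum-cong λ v → cong (λ b → sign b * xˡ v) (cong₂ (double (minus S)) (splitAt-↑ʳ N N u) (splitAt-↑ˡ N v N)))
      (trans (sum-cong λ v → trans
          (cong (λ b → sign b * xʳ v) (cong₂ (double (minus S)) (splitAt-↑ʳ N N u) (splitAt-↑ʳ N N v)))
          (trans (cong (_* xʳ v) (sign-not (minus S u v)))
            (solve 2 (λ s x → (:- s) :* x := con (- 1ℚ) :* (s :* x)) refl (sign (minus S u v)) (xʳ v))))
        (trans (sum-*ˡ (- 1ℚ) (λ v → sign (minus S u v) * xʳ v))
          (solve 1 (λ r → con (- 1ℚ) :* r := :- r) refl (r u)))))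
    X = sum λ v → xˡ v * xˡ v
    Y = sum λ v → xʳ v * xʳ v
    -- The parallelogram law (p + r)² + (p - r)² = 2 p² + 2 r² cancels the mixed terms and doubles
    -- the constant.
    bound′ : sum (λ u → row u * row u) ≤ ⟦ N ℕ.+ N ⟧ * sum (λ v → x v * x v)
    bound′ = begin
      sum (λ u → row u * row u) ≡⟨ sum-split N (λ u → row u * row u) ⟩
      sum (λ u → row (u ↑ˡ N) * row (u ↑ˡ N)) + sum (λ u → row (N ↑ʳ u) * row (N ↑ʳ u))
        ≡⟨ cong₂ _+_ (sum-cong λ u → cong₂ _*_ (rowˡ u) (rowˡ u)) (sum-cong λ u → cong₂ _*_ (rowʳ u) (rowʳ u)) ⟩
      sum (λ u → (p u + r u) * (p u + r u)) + sum (λ u → (p u - r u) * (p u - r u))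
        ≡⟨ sum-+ (λ u → (p u + r u) * (p u + r u)) (λ u → (p u - r u) * (p u - r u)) ⟨
      sum (λ u → (p u + r u) * (p u + r u) + (p u - r u) * (p u - r u))
        ≡⟨ sum-cong (λ u → solve 2 (λ p r → (p :+ r) :* (p :+ r) :+ (p :- r) :* (p :- r) := p :* p :+ r :* r :+ (p :* p :+ r :* r)) refl (p u) (r u)) ⟩
      sum (λ u → p u * p u + r u * r u + (p u * p u + r u * r u))
        ≡⟨ trans (sum-+ (λ u → p u * p u + r u * r u) (λ u → p u * p u + r u * r u)) (cong (λ z → z + z) (sum-+ (λ u → p u * p u) (λ u → r u * r u))) ⟩
      sum (λ u → p u * p u) + sum (λ u → r u * r u) + (sum (λ u → p u * p u) + sum (λ u → r u * r u))
        ≤⟨ +-mono-≤ (+-mono-≤ (bound S xˡ) (bound S xʳ)) (+-mono-≤ (bound S xˡ) (bound S xʳ)) ⟩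
      ⟦ N ⟧ * X + ⟦ N ⟧ * Y + (⟦ N ⟧ * X + ⟦ N ⟧ * Y)
        ≡⟨ solve 3 (λ N X Y → N :* X :+ N :* Y :+ (N :* X :+ N :* Y) := (N :+ N) :* (X :+ Y)) refl ⟦ N ⟧ X Y ⟩
      (⟦ N ⟧ + ⟦ N ⟧) * (X + Y) ≡⟨ cong₂ _*_ (⟦⟧-+ N N) (sum-split N (λ v → x v * x v)) ⟨
      ⟦ N ℕ.+ N ⟧ * sum (λ v → x v * x v) ∎

-- Extending `x` by zeros keeps its norm, and dropping rows of the image can only lower the left
-- side.
restrict : ∀ {n r C} → SignMatrix (n ℕ.+ r) C → SignMatrix n C
restrict {n} {r} {C} S = record
  { minus = λ u v → minus S (u ↑ˡ r) (v ↑ˡ r)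
  ; symmetric = λ u v → symmetric S (u ↑ˡ r) (v ↑ˡ r)
  ; bound = bound′ }
  where
  module _ (x : Fin n → ℚ) where
    open ≤-Reasoning
    x₀ : Fin (n ℕ.+ r) → ℚ
    x₀ v = [ x , (λ _ → 0ℚ) ]′ (splitAt n v)
    sum-x₀ : ∀ (g : Fin (n ℕ.+ r) → ℚ → ℚ) → (∀ v → g v 0ℚ ≡ 0ℚ) → sum (λ v → g v (x₀ v)) ≡ sum (λ v → g (v ↑ˡ r) (x v))
    sum-x₀ g g0 = trans (sum-split n (λ v → g v (x₀ v))) (trans (cong₂ _+_
      (sum-cong λ v → cong (λ z → g (v ↑ˡ r) ([ x , (λ _ → 0ℚ) ]′ z)) (splitAt-↑ˡ n v r))
      (trans (sum-cong λ v → trans (cong (λ z → g (n ↑ʳ v) ([ x , (λ _ → 0ℚ) ]′ z)) (splitAt-↑ʳ n r v)) (g0 (n ↑ʳ v)))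
        (trans (sum-const r 0ℚ) (*-zeroʳ ⟦ r ⟧)))) (+-identityʳ (sum λ v → g (v ↑ˡ r) (x v))))
    row₀ : Fin (n ℕ.+ r) → ℚ
    row₀ u = sum λ v → sign (minus S u v) * x₀ v
    row : Fin n → ℚ
    row u = sum λ v → sign (minus S (u ↑ˡ r) (v ↑ˡ r)) * x v
    row-eq : ∀ u → row u ≡ row₀ (u ↑ˡ r)
    row-eq u = sym (sum-x₀ (λ v z → sign (minus S (u ↑ˡ r) v) * z) (λ v → *-zeroʳ (sign (minus S (u ↑ˡ r) v))))
    bound′ : sum (λ u → row u * row u) ≤ C * sum (λ v → x v * x v)
    bound′ = begin
      sum (λ u → row u * row u)                           ≡⟨ sum-cong (λ u → cong₂ _*_ (row-eq u) (row-eq u)) ⟩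
      sum (λ u → row₀ (u ↑ˡ r) * row₀ (u ↑ˡ r))           ≤⟨ ≤-addʳ _ (sum-nonneg λ u → square-nonneg (row₀ (n ↑ʳ u))) ⟩
      sum (λ u → row₀ (u ↑ˡ r) * row₀ (u ↑ˡ r)) + sum (λ u → row₀ (n ↑ʳ u) * row₀ (n ↑ʳ u)) ≡⟨ sum-split n (λ u → row₀ u * row₀ u) ⟨
      sum (λ u → row₀ u * row₀ u)                         ≤⟨ bound S x₀ ⟩
      C * sum (λ v → x₀ v * x₀ v)                         ≡⟨ cong (C *_) (sum-x₀ (λ _ z → z * z) (λ _ → refl)) ⟩
      C * sum (λ v → x v * x v)                           ∎

pow2-between : ∀ n → ∃[ K ] suc n ℕ.≤ pow2 K × pow2 K ℕ.≤ suc n ℕ.+ suc n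
pow2-between zero = 0 , ℕ.≤-refl , ℕ.s≤s ℕ.z≤n
pow2-between (suc n) = next (pow2-between n)
  where
  next : ∃[ K ] suc n ℕ.≤ pow2 K × pow2 K ℕ.≤ suc n ℕ.+ suc n →
    ∃[ K ] suc (suc n) ℕ.≤ pow2 K × pow2 K ℕ.≤ suc (suc n) ℕ.+ suc (suc n)
  next (K , n<P , P≤) with suc (suc n) ℕ.≤? pow2 K
  ... | yes n+2≤P = K , n+2≤P , ℕ.≤-trans P≤ (ℕ.+-mono-≤ (ℕ.n≤1+n (suc n)) (ℕ.n≤1+n (suc n)))
  ... | no P≤n+1 = suc K , ℕ.≤-trans (ℕ.s≤s (ℕ.m≤n+m (suc n) n)) (ℕ.+-mono-≤ n<P n<P) ,
    ℕ.+-mono-≤ (ℕ.<⇒≤ (ℕ.≰⇒> P≤n+1)) (ℕ.<⇒≤ (ℕ.≰⇒> P≤n+1))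

-- Some power of two lies between the required order and its double, so cutting down costs at most a
-- factor 2 in the norm bound.
sign-matrix : ∀ n → SignMatrix (suc n) ⟦ suc n ℕ.+ suc n ⟧
sign-matrix n with pow2-between n
... | K , n<P , P≤ = record
  { minus = minus S
  ; symmetric = symmetric S
  ; bound = λ x → ≤-trans (bound S x) (*-mono-≤ʳ (sum-nonneg λ v → square-nonneg (x v)) (⟦⟧-≤ P≤)) }
  where
  S : SignMatrix (suc n) ⟦ pow2 K ⟧
  S = restrict {r = pow2 K ℕ.∸ suc n} (subst (λ N → SignMatrix N ⟦ pow2 K ⟧) (sym (ℕ.m+[n∸m]≡n n<P)) (hadamard K))

-- The quasirandom graph

2ℚ : ℚ
2ℚ = 1ℚ + 1ℚ

∑∈-cong∈ : ∀ {n} (A : Subset n) {f g : Fin n → ℚ} → (∀ {u} → u ∈ A → f u ≡ g u) → ∑∈ A f ≡ ∑∈ A g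
∑∈-cong∈ A f≡g = ≤-antisym (∑∈-mono A λ u∈A → ≤-reflexive (f≡g u∈A)) (∑∈-mono A λ u∈A → ≤-reflexive (sym (f≡g u∈A)))

-- The diagonal signs are discarded to avoid loops. Signs and edges then still agree between
-- disjoint sets, the only place where they are compared.
quasirandom : ∀ {n C} → SignMatrix n C → Graph n
quasirandom S = record
  { adj = λ u v → not (does (u Finₚ.≟ v)) ∧ minus S u v
  ; sym = λ u v → cong₂ (λ b c → not b ∧ c) (flip u v) (symmetric S u v)
  ; irrefl = λ u → cong (λ b → not b ∧ minus S u u) (dec-true (u Finₚ.≟ u) refl) }
  where
  flip : ∀ u v → does (u Finₚ.≟ v) ≡ does (v Finₚ.≟ u)
  flip u v with u Finₚ.≟ v
  ... | yes u≡v = sym (dec-true (v Finₚ.≟ u) (sym u≡v))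
  ... | no u≢v = sym (dec-false (v Finₚ.≟ u) (u≢v ∘ sym))

module _ {n C} (S : SignMatrix n C) where
  sgn : Fin n → Fin n → ℚ
  sgn u v = sign (minus S u v)

  sgn-edge : ∀ {u v} → ¬ (u ≡ v) → sgn u v ≡ (- 2ℚ) * edge (quasirandom S) u v + 1ℚ
  sgn-edge {u} {v} u≢v = trans (eq (minus S u v)) (cong (λ b → (- 2ℚ) * ind (not b ∧ minus S u v) + 1ℚ) (sym (dec-false (u Finₚ.≟ v) u≢v)))
    where
    eq : ∀ b → sign b ≡ (- 2ℚ) * ind b + 1ℚ
    eq true = refl
    eq false = refl

  bil-sgn : ∀ {A B L} → Disjoint A B → card A ≡ L → card B ≡ L →
    bil sgn A B ≡ (- 2ℚ) * bil (edge (quasirandom S)) A B + ⟦ L ⟧ * ⟦ L ⟧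
  bil-sgn {A} {B} {L} A∩B=∅ |A| |B| = begin-equality
    bil sgn A B
      ≡⟨ ∑∈-cong∈ A (λ u∈A → ∑∈-cong∈ B λ v∈B → sgn-edge λ { refl → A∩B=∅ _ (u∈A , v∈B) }) ⟩
    bil (λ u v → (- 2ℚ) * edge (quasirandom S) u v + 1ℚ) A B
      ≡⟨ bil-affine A B (- 2ℚ) 1ℚ (edge (quasirandom S)) ⟩
    (- 2ℚ) * bil (edge (quasirandom S)) A B + ⟦ card A ⟧ * ⟦ card B ⟧ * 1ℚ
      ≡⟨ cong (_+_ ((- 2ℚ) * bil (edge (quasirandom S)) A B)) (trans (*-identityʳ _) (cong₂ (λ a b → ⟦ a ⟧ * ⟦ b ⟧) |A| |B|)) ⟩
    (- 2ℚ) * bil (edge (quasirandom S)) A B + ⟦ L ⟧ * ⟦ L ⟧ ∎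
    where open ≤-Reasoning

  -- AM–GM, 2 t σ g ≤ t² + g², for every row sum g, with t = 2 ε L.
  discrepancy : ∀ {A B L ε} σ → σ * σ ≡ 1ℚ → 0ℚ < ε → 0 ℕ.< L → card A ≡ L → card B ≡ L →
    C ≤ 2ℚ * 2ℚ * (ε * ε * (⟦ L ⟧ * ⟦ L ⟧)) → σ * bil sgn A B ≤ 2ℚ * ε * (⟦ L ⟧ * ⟦ L ⟧)
  discrepancy {A} {B} {L} {ε} σ σσ≡1 0<ε 0<L |A| |B| C≤ = *-cancel-≤ˡ 0<2t (begin
    (t + t) * (σ * bil sgn A B)             ≡⟨ *-assoc (t + t) σ (bil sgn A B) ⟨
    (t + t) * σ * bil sgn A B               ≡⟨ ∑∈-* A ((t + t) * σ) g ⟨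
    ∑∈ A (λ u → (t + t) * σ * g u)          ≤⟨ ∑∈-mono A (λ {u} _ → am-gm (g u)) ⟩
    ∑∈ A (λ u → t * t + g u * g u)          ≡⟨ ∑∈-+ A (λ _ → t * t) (λ u → g u * g u) ⟩
    ∑∈ A (λ _ → t * t) + ∑∈ A (λ u → g u * g u)
      ≤⟨ +-mono-≤ (≤-reflexive (trans (∑∈-const A (t * t)) (cong (λ z → ⟦ z ⟧ * (t * t)) |A|)))
           (≤-trans (∑∈≤sum A λ u → square-nonneg (g u)) rows) ⟩
    ℓ * (t * t) + C * ℓ                     ≤⟨ +-monoʳ-≤ (ℓ * (t * t)) (*-mono-≤ʳ (⟦⟧-nonneg L) C≤) ⟩
    ℓ * (t * t) + 2ℚ * 2ℚ * (ε * ε * (ℓ * ℓ)) * ℓ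
      ≡⟨ solve 3 (λ c ε ℓ → ℓ :* (c :* (ε :* ℓ) :* (c :* (ε :* ℓ))) :+ c :* c :* (ε :* ε :* (ℓ :* ℓ)) :* ℓ
             := (c :* (ε :* ℓ) :+ c :* (ε :* ℓ)) :* (c :* ε :* (ℓ :* ℓ))) refl 2ℚ ε ℓ ⟩
    (t + t) * (2ℚ * ε * (ℓ * ℓ))            ∎)
    where
    open ≤-Reasoning
    ℓ = ⟦ L ⟧
    t = 2ℚ * (ε * ℓ)
    g : Fin n → ℚ
    g u = ∑∈ B (sgn u)
    0<t : 0ℚ < t
    0<t = *-pos {2ℚ} (positive⁻¹ 2ℚ) (*-pos 0<ε (subst (_< ℓ) ⟦⟧-0 (⟦⟧-< 0<L)))
    0<2t : 0ℚ < t + t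
    0<2t = +-mono-< 0<t 0<t
    am-gm : ∀ x → (t + t) * σ * x ≤ t * t + x * x
    am-gm x = ≤-by ((t - σ * x) * (t - σ * x)) (square-nonneg (t - σ * x)) (trans
      (cong (λ z → t * t + z) (trans (sym (*-identityˡ (x * x))) (cong (_* (x * x)) (sym σσ≡1))))
      (solve 3 (λ t σ x → t :* t :+ σ :* σ :* (x :* x) := (t :+ t) :* σ :* x :+ (t :- σ :* x) :* (t :- σ :* x)) refl t σ x))
    χ²≡χ : ∀ v → χ B v * χ B v ≡ χ B v
    χ²≡χ v with lookup B v
    ... | true = refl
    ... | false = refl
    rows : sum (λ u → g u * g u) ≤ C * ℓ
    rows = begin
      sum (λ u → g u * g u)
        ≡⟨ sum-cong (λ u → cong (λ z → z * z) (sum-cong λ v → *-comm (χ B v) (sgn u v))) ⟩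
      sum (λ u → sum (λ v → sgn u v * χ B v) * sum (λ v → sgn u v * χ B v)) ≤⟨ bound S (χ B) ⟩
      C * sum (λ v → χ B v * χ B v)
        ≡⟨ cong (C *_) (trans (sum-cong χ²≡χ) (trans (χ-card B) (cong ⟦_⟧ |B|))) ⟩
      C * ℓ ∎

-- Edits: their cost and their number

changed : ∀ {n} → Graph n → Graph n → Fin n → Fin n → ℚ
changed G H u v = ind (adj G u v xor adj H u v)

edge≤changed+edge : ∀ {n} (G H : Graph n) u v → edge G u v ≤ changed G H u v + edge H u v
edge≤changed+edge G H u v with adj G u v | adj H u v
... | true | true = ≤ᵇ⇒≤ tt
... | true | false = ≤ᵇ⇒≤ tt
... | false | true = ≤ᵇ⇒≤ tt
... | false | false = ≤ᵇ⇒≤ tt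

edge≤changed+edge′ : ∀ {n} (G H : Graph n) u v → edge H u v ≤ changed G H u v + edge G u v
edge≤changed+edge′ G H u v with adj G u v | adj H u v
... | true | true = ≤ᵇ⇒≤ tt
... | true | false = ≤ᵇ⇒≤ tt
... | false | true = ≤ᵇ⇒≤ tt
... | false | false = ≤ᵇ⇒≤ tt

-- The density g of `G` is within ε of 1/2, the density of `H` is at least 1/2 - δ away from 1/2,
-- and the two differ by at most the edit density. Everything is doubled to avoid the fraction 1/2.
extreme-density-cost : ∀ {n C} (S : SignMatrix n C) (H : Graph n) {A B L ε δ} → 0ℚ < ε → 0 ℕ.< L →
  Disjoint A B → card A ≡ L → card B ≡ L → C ≤ 2ℚ * 2ℚ * (ε * ε * (⟦ L ⟧ * ⟦ L ⟧)) →
  density H A B ≤ δ ⊎ 1ℚ - δ ≤ density H A B →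
  1ℚ - 2ℚ * (ε + δ) ≤ 2ℚ * (bil (changed (quasirandom S) H) A B * inv L)
extreme-density-cost S H {A} {B} {L} {ε} {δ} 0<ε 0<L A∩B=∅ |A| |B| C≤ = cost
  where
  open ≤-Reasoning
  G = quasirandom S
  i = inv L
  ℓ² = ⟦ L ⟧ * ⟦ L ⟧
  D = bil (changed G H) A B * i
  g = bil (edge G) A B * i
  h = bil (edge H) A B * i
  0≤i : 0ℚ ≤ i
  0≤i = inv-nonneg 0<L
  dH : density H A B ≡ h
  dH = density-inv H A B 0<L |A| |B|
  compare : ∀ {w w′} → (∀ u v → w u v ≤ changed G H u v + w′ u v) → bil w A B * i ≤ D + bil w′ A B * i
  compare {w} {w′} le = ≤-trans (*-mono-≤ʳ 0≤i (bil-mono A B le)) (≤-reflexive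
    (trans (cong (_* i) (bil-+ A B (changed G H) w′)) (*-distribʳ-+ i (bil (changed G H) A B) (bil w′ A B))))
  g≤D+h : g ≤ D + h
  g≤D+h = compare {edge G} {edge H} (edge≤changed+edge G H)
  h≤D+g : h ≤ D + g
  h≤D+g = compare {edge H} {edge G} (edge≤changed+edge′ G H)
  -- Taken for σ = 1 and σ = -1, this is |1 - 2 g| ≤ 2 ε.
  half : ∀ σ → σ * σ ≡ 1ℚ → σ * (1ℚ - 2ℚ * g) ≤ 2ℚ * ε
  half σ σσ≡1 = begin
    σ * (1ℚ - 2ℚ * g)                               ≡⟨ cong (λ z → σ * (z - 2ℚ * g)) (inv-* 0<L) ⟨
    σ * (i * ℓ² - 2ℚ * g)                           ≡⟨ solve 5 (λ σ i l c b → σ :* (i :* l :- c :* (b :* i)) := σ :* ((:- c) :* b :+ l) :* i) refl σ i ℓ² 2ℚ (bil (edge G) A B) ⟩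
    σ * ((- 2ℚ) * bil (edge G) A B + ℓ²) * i        ≡⟨ cong (λ z → σ * z * i) (bil-sgn S A∩B=∅ |A| |B|) ⟨
    σ * bil (sgn S) A B * i                         ≤⟨ *-mono-≤ʳ 0≤i (discrepancy S {A} {B} σ σσ≡1 0<ε 0<L |A| |B| C≤) ⟩
    2ℚ * ε * ℓ² * i                                 ≡⟨ solve 3 (λ x l i → x :* l :* i := i :* l :* x) refl (2ℚ * ε) ℓ² i ⟩
    i * ℓ² * (2ℚ * ε)                               ≡⟨ cong (_* (2ℚ * ε)) (inv-* 0<L) ⟩
    1ℚ * (2ℚ * ε)                                   ≡⟨ *-identityˡ (2ℚ * ε) ⟩
    2ℚ * ε                                          ∎
  0≤2 : 0ℚ ≤ 2ℚ
  0≤2 = nonNegative⁻¹ 2ℚ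
  cost : density H A B ≤ δ ⊎ 1ℚ - δ ≤ density H A B → 1ℚ - 2ℚ * (ε + δ) ≤ 2ℚ * D
  -- The certificate adds the slacks of `half`, of the triangle inequality and of the assumption on
  -- the density.
  cost (inj₁ d≤δ) = ≤-by (2ℚ * ε - 1ℚ * (1ℚ - 2ℚ * g) + (2ℚ * (D + h - g) + 2ℚ * (δ - h)))
    (+-nonneg (≤⇒0≤- (half 1ℚ refl)) (+-nonneg (*-nonneg 0≤2 (≤⇒0≤- g≤D+h)) (*-nonneg 0≤2 (≤⇒0≤- (subst (_≤ δ) dH d≤δ)))))
    (solve 6 (λ c ε δ g h D → c :* D := con 1ℚ :- c :* (ε :+ δ) :+
      (c :* ε :- con 1ℚ :* (con 1ℚ :- c :* g) :+ (c :* (D :+ h :- g) :+ c :* (δ :- h)))) refl 2ℚ ε δ g h D)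
  cost (inj₂ d≥1-δ) = ≤-by (2ℚ * ε - (- 1ℚ) * (1ℚ - 2ℚ * g) + (2ℚ * (D + g - h) + 2ℚ * (h - (1ℚ - δ))))
    (+-nonneg (≤⇒0≤- (half (- 1ℚ) refl)) (+-nonneg (*-nonneg 0≤2 (≤⇒0≤- h≤D+g)) (*-nonneg 0≤2 (≤⇒0≤- (subst (1ℚ - δ ≤_) dH d≥1-δ)))))
    (solve 5 (λ ε δ g h D → con 2ℚ :* D := con 1ℚ :- con 2ℚ :* (ε :+ δ) :+
      (con 2ℚ :* ε :- con (- 1ℚ) :* (con 1ℚ :- con 2ℚ :* g) :+ (con 2ℚ :* (D :+ g :- h) :+ con 2ℚ :* (h :- (con 1ℚ :- δ))))) refl ε δ g h D)

changed-sym : ∀ {n} (G H : Graph n) u v → changed G H u v ≡ changed G H v u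
changed-sym G H u v = cong₂ (λ a b → ind (a xor b)) (Graph.sym G u v) (Graph.sym H u v)

-- Ordered pairs see every edit twice, and the diagonal contributes nothing because both graphs are
-- loopless.
∑changed : ∀ {n} (G H : Graph n) → sum₂ (changed G H) ≡ 2ℚ * ⟦ editDist G H ⟧
∑changed {n} G H = begin-equality
  sum₂ (changed G H)                                  ≡⟨ sum-cong (λ u → sum-cong λ v → split u v) ⟩
  sum₂ (λ u v → up u v + up v u)                      ≡⟨ trans (sum-cong λ u → sum-+ (up u) (λ v → up v u)) (sum-+ (λ u → sum (up u)) (λ u → sum λ v → up v u)) ⟩
  sum₂ up + sum₂ (λ u v → up v u)                     ≡⟨ cong (_+_ (sum₂ up)) (sum-comm λ u v → up v u) ⟩
  sum₂ up + sum₂ up                                   ≡⟨ solve 1 (λ x → x :+ x := con 2ℚ :* x) refl (sum₂ up) ⟩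
  2ℚ * sum₂ up                                        ≡⟨ cong (2ℚ *_) (trans (⟦⟧-sum λ u → sumFin (count u)) (sum-cong λ u →
                                                          trans (⟦⟧-sum (count u)) (sum-cong λ v → term ⌊ u Finₚ.<? v ⌋ (adj G u v xor adj H u v)))) ⟨
  2ℚ * ⟦ editDist G H ⟧                               ∎
  where
  open ≤-Reasoning
  count : Fin n → Fin n → ℕ
  count u v = if ⌊ u Finₚ.<? v ⌋ ∧ (adj G u v xor adj H u v) then 1 else 0
  up : Fin n → Fin n → ℚ
  up u v = ind ⌊ u Finₚ.<? v ⌋ * changed G H u v
  term : ∀ x y → ⟦ if x ∧ y then 1 else 0 ⟧ ≡ ind x * ind y
  term true true = ⟦⟧-1
  term true false = ⟦⟧-0
  term false y = trans ⟦⟧-0 (sym (*-zeroˡ (ind y)))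
  isYes-true : ∀ {P : Set} (P? : Dec P) → P → ⌊ P? ⌋ ≡ true
  isYes-true P? p = trans (isYes≗does P?) (dec-true P? p)
  isYes-false : ∀ {P : Set} (P? : Dec P) → ¬ P → ⌊ P? ⌋ ≡ false
  isYes-false P? ¬p = trans (isYes≗does P?) (dec-false P? ¬p)
  up-≡ : ∀ {b} u v → ⌊ u Finₚ.<? v ⌋ ≡ b → up u v ≡ ind b * changed G H u v
  up-≡ u v eq = cong (λ b → ind b * changed G H u v) eq
  split : ∀ u v → changed G H u v ≡ up u v + up v u
  split u v with Finₚ.<-cmp u v
  ... | tri< u<v _ v≮u = sym (trans (cong₂ _+_ (up-≡ u v (isYes-true (u Finₚ.<? v) u<v)) (up-≡ v u (isYes-false (v Finₚ.<? u) v≮u)))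
    (solve 2 (λ x y → con 1ℚ :* x :+ con 0ℚ :* y := x) refl (changed G H u v) (changed G H v u)))
  ... | tri> u≮v _ v<u = sym (trans (cong₂ _+_ (up-≡ u v (isYes-false (u Finₚ.<? v) u≮v)) (up-≡ v u (isYes-true (v Finₚ.<? u) v<u)))
    (trans (solve 2 (λ x y → con 0ℚ :* x :+ con 1ℚ :* y := y) refl (changed G H u v) (changed G H v u)) (changed-sym G H v u)))
  ... | tri≈ u≮u refl _ = trans (cong₂ (λ a b → ind (a xor b)) (irrefl G u) (irrefl H u))
    (sym (trans (cong (λ z → z + z) (up-≡ u u (isYes-false (u Finₚ.<? u) u≮u)))
      (solve 1 (λ x → con 0ℚ :* x :+ con 0ℚ :* x := con 0ℚ) refl (changed G H u u))))

changed-nonneg : ∀ {n} (G H : Graph n) u v → 0ℚ ≤ changed G H u v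
changed-nonneg G H u v = ind-nonneg (adj G u v xor adj H u v)

-- Leaving out the vertices outside `A` and the pairs within one part can only lose edits.
blocks-edits : ∀ {n k L} (G H : Graph n) {A : Subset n} (𝓑 : Blocks k L A) →
  pairSum (λ i j → bil (changed G H) (part 𝓑 i) (part 𝓑 j)) ≤ 2ℚ * ⟦ editDist G H ⟧
blocks-edits {n} G H {A} 𝓑 = begin
  pairSum D                        ≤⟨ ≤-addˡ (pairSum D) (sum-nonneg λ i → D-nonneg i i) ⟩
  sum (λ i → D i i) + pairSum D    ≡⟨ pairSum-diagonal D ⟨
  sum₂ D                           ≡⟨ bil-blocks 𝓑 𝓑 (changed G H) ⟨
  bil (changed G H) A A            ≤⟨ ∑∈-mono A (λ {u} _ → ∑∈≤sum A (changed-nonneg G H u)) ⟩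
  ∑∈ A (λ u → sum (changed G H u)) ≤⟨ ∑∈≤sum A (λ u → sum-nonneg (changed-nonneg G H u)) ⟩
  sum₂ (changed G H)               ≡⟨ ∑changed G H ⟩
  2ℚ * ⟦ editDist G H ⟧            ∎
  where
  open ≤-Reasoning
  D : _ → _ → ℚ
  D i j = bil (changed G H) (part 𝓑 i) (part 𝓑 j)
  D-nonneg : ∀ i j → 0ℚ ≤ D i j
  D-nonneg i j = ∑∈-nonneg (part 𝓑 i) λ {u} _ → ∑∈-nonneg (part 𝓑 j) λ {v} _ → changed-nonneg G H u v

-- Counting edits

numerator-bound : ∀ {x} → 0ℚ ≤ x → ∃[ p ] x ≤ ⟦ p ⟧
numerator-bound {mkℚ -[1+ _ ] d c} (*≤* ())
numerator-bound {x@(mkℚ (+ p) d c)} 0≤x = p , (begin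
  x                        ≡⟨ *-identityʳ x ⟨
  x * 1ℚ                   ≤⟨ *-mono-≤ˡ 0≤x (subst (_≤ ⟦ suc d ⟧) ⟦⟧-1 (⟦⟧-≤ (ℕ.s≤s ℕ.z≤n))) ⟩
  x * ⟦ suc d ⟧            ≡⟨ cong (_* ⟦ suc d ⟧) (↥p/↧p≡p x) ⟨
  frac p (suc d) * ⟦ suc d ⟧ ≡⟨ frac-* p (suc d) ℕ.z<s ⟩
  ⟦ p ⟧                    ∎)
  where open ≤-Reasoning

-- The denominator of `x` serves, the numerator being at least 1.
denominator-bound : ∀ {x} → 0ℚ < x → ∃[ d ] 1ℚ ≤ ⟦ suc d ⟧ * x
denominator-bound {mkℚ -[1+ _ ] d c} (*<* ())
denominator-bound {mkℚ (+ zero) d c} (*<* (+<+ ()))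
denominator-bound {x@(mkℚ (+ suc a) d c)} _ = d , (begin
  1ℚ                             ≡⟨ ⟦⟧-1 ⟨
  ⟦ 1 ⟧                          ≤⟨ ⟦⟧-≤ (ℕ.s≤s ℕ.z≤n) ⟩
  ⟦ suc a ⟧                      ≡⟨ frac-* (suc a) (suc d) ℕ.z<s ⟨
  frac (suc a) (suc d) * ⟦ suc d ⟧ ≡⟨ *-comm (frac (suc a) (suc d)) ⟦ suc d ⟧ ⟩
  ⟦ suc d ⟧ * frac (suc a) (suc d) ≡⟨ cong (⟦ suc d ⟧ *_) (↥p/↧p≡p x) ⟩
  ⟦ suc d ⟧ * x                  ∎)
  where open ≤-Reasoning

archimedean : ∀ {x y} → 0ℚ ≤ x → 0ℚ < y → ∃[ t ] x < ⟦ t ⟧ * y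
archimedean {x} {y} 0≤x 0<y =
  let p , x≤p = numerator-bound 0≤x
      d , 1≤dy = denominator-bound 0<y
  in suc p ℕ.* suc d , (begin-strict
    x                          ≤⟨ x≤p ⟩
    ⟦ p ⟧                      <⟨ ⟦⟧-< (ℕ.n<1+n p) ⟩
    ⟦ suc p ⟧                  ≡⟨ *-identityʳ ⟦ suc p ⟧ ⟨
    ⟦ suc p ⟧ * 1ℚ             ≤⟨ *-mono-≤ˡ (⟦⟧-nonneg (suc p)) 1≤dy ⟩
    ⟦ suc p ⟧ * (⟦ suc d ⟧ * y) ≡⟨ *-assoc ⟦ suc p ⟧ ⟦ suc d ⟧ y ⟨
    ⟦ suc p ⟧ * ⟦ suc d ⟧ * y  ≡⟨ cong (_* y) (⟦⟧-* (suc p) (suc d)) ⟨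
    ⟦ suc p ℕ.* suc d ⟧ * y    ∎)
  where open ≤-Reasoning

3ℚ 5ℚ : ℚ
3ℚ = + 3 / 1
5ℚ = + 5 / 1

-- Here `E` counts the edits, `X` is the final normalised edit sum, `P` the number of ordered
-- extreme pairs, and `ℓ` the size of the initial sets. Multiplying Turán's bound by θ = 1 - 2 (ε +
-- δ) and inserting the other bounds gives θ K² ≤ 3 s ε K² + η K² with η = 1 - 3 δ. Since θ - η = δ
-- - 2 ε, this means δ ≤ 2 ε + 3 s ε ≤ 5 s ε, a contradiction.
edits-too-few : ∀ {ε δ s K ν ℓ i E X P} → 0ℚ < ε → 0ℚ ≤ δ → 1ℚ ≤ s → 5ℚ * (s * ε) < δ →
  0ℚ < K → 1ℚ ≤ K * ε → 0ℚ ≤ (1ℚ - ε) * ν → (1ℚ - ε) * ν ≤ K * ℓ → 0ℚ ≤ i → i * (ℓ * ℓ) ≡ 1ℚ → 0ℚ ≤ E →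
  E * (2ℚ * 2ℚ * s) < ν * ν * (1ℚ - 3ℚ * δ) * ((1ℚ - ε) * (1ℚ - ε)) →
  X ≤ 2ℚ * E * i + ε * (K * K) → (1ℚ - 2ℚ * (ε + δ)) * P ≤ 2ℚ * X → K * K ≤ s * (K + P) → ⊥
edits-too-few {ε} {δ} {s} {K} {ν} {ℓ} {i} {E} {X} {P} 0<ε 0≤δ 1≤s small 0<K 1≤Kε 0≤ν′ ν′≤Kℓ 0≤i iℓ²≡1 0≤E few X≤ θP≤ K²≤ =
  <-irrefl refl (<-≤-trans small δ≤)
  where
  open ≤-Reasoning
  η = 1ℚ - 3ℚ * δ
  θ = 1ℚ - 2ℚ * (ε + δ)
  ν′ = (1ℚ - ε) * ν
  0≤ε = <⇒≤ 0<ε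
  0≤1 : 0ℚ ≤ 1ℚ
  0≤1 = nonNegative⁻¹ 1ℚ
  0≤2 : 0ℚ ≤ 2ℚ
  0≤2 = nonNegative⁻¹ 2ℚ
  0≤s = ≤-trans 0≤1 1≤s
  0≤K = <⇒≤ 0<K
  -- For negative 1 - 3 δ the number of edits would have to lie below a nonpositive bound.
  0≤η : 0ℚ ≤ η
  0≤η with ≤-total 0ℚ η
  ... | inj₁ 0≤η = 0≤η
  ... | inj₂ η≤0 = contradiction (<-≤-trans few (≤-trans nonpos (*-nonneg 0≤E (*-nonneg (nonNegative⁻¹ (2ℚ * 2ℚ)) 0≤s)))) (<-irrefl refl)
    where
    nonpos : ν * ν * η * ((1ℚ - ε) * (1ℚ - ε)) ≤ 0ℚ
    nonpos = ≤-by (ν * ν * (- η) * ((1ℚ - ε) * (1ℚ - ε)))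
      (*-nonneg (*-nonneg (square-nonneg ν) (neg-antimono-≤ η≤0)) (square-nonneg (1ℚ - ε)))
      (solve 3 (λ a η c → con 0ℚ := a :* η :* c :+ a :* (:- η) :* c) refl (ν * ν) η ((1ℚ - ε) * (1ℚ - ε)))
  -- The initial sets cover at least (1 - ε) n vertices, which absorbs the factor (1 - ε)² in the
  -- permitted number of edits.
  edits : E * (2ℚ * 2ℚ * s) * i ≤ η * (K * K)
  edits = begin
    E * (2ℚ * 2ℚ * s) * i                           ≤⟨ *-mono-≤ʳ 0≤i (<⇒≤ few) ⟩
    ν * ν * η * ((1ℚ - ε) * (1ℚ - ε)) * i           ≡⟨ solve 4 (λ ν η c i → ν :* ν :* η :* (c :* c) :* i := η :* (i :* (c :* ν :* (c :* ν)))) refl ν η (1ℚ - ε) i ⟩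
    η * (i * (ν′ * ν′))                             ≤⟨ *-mono-≤ˡ 0≤η (*-mono-≤ˡ 0≤i (square-mono 0≤ν′ ν′≤Kℓ)) ⟩
    η * (i * (K * ℓ * (K * ℓ)))                     ≡⟨ solve 4 (λ η i K ℓ → η :* (i :* (K :* ℓ :* (K :* ℓ))) := η :* (K :* K) :* (i :* (ℓ :* ℓ))) refl η i K ℓ ⟩
    η * (K * K) * (i * (ℓ * ℓ))                     ≡⟨ trans (cong (η * (K * K) *_) iℓ²≡1) (*-identityʳ _) ⟩
    η * (K * K)                                     ∎
  2ε+3sε≤5sε : 2ℚ * ε + 3ℚ * (s * ε) ≤ 5ℚ * (s * ε)
  2ε+3sε≤5sε = ≤-by (2ℚ * ε * (s - 1ℚ)) (*-nonneg (*-nonneg 0≤2 0≤ε) (≤⇒0≤- 1≤s))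
    (solve 2 (λ ε s → con 5ℚ :* (s :* ε) := con 2ℚ :* ε :+ con 3ℚ :* (s :* ε) :+ con 2ℚ :* ε :* (s :- con 1ℚ)) refl ε s)
  2ε≤δ : 2ℚ * ε ≤ δ
  2ε≤δ = ≤-trans (≤-addʳ (2ℚ * ε) (*-nonneg (nonNegative⁻¹ 3ℚ) (*-nonneg 0≤s 0≤ε))) (≤-trans 2ε+3sε≤5sε (<⇒≤ small))
  0≤θ : 0ℚ ≤ θ
  0≤θ = subst (0ℚ ≤_) (solve 2 (λ ε δ → con 1ℚ :- con 3ℚ :* δ :+ (δ :- con 2ℚ :* ε) := con 1ℚ :- con 2ℚ :* (ε :+ δ)) refl ε δ)
    (+-nonneg 0≤η (≤⇒0≤- 2ε≤δ))
  θ≤1 : θ ≤ 1ℚ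
  θ≤1 = ≤-by (2ℚ * (ε + δ)) (*-nonneg 0≤2 (+-nonneg 0≤ε 0≤δ)) (solve 1 (λ x → con 1ℚ := con 1ℚ :- x :+ x) refl (2ℚ * (ε + δ)))
  K≤εK² : K ≤ ε * (K * K)
  K≤εK² = begin
    K             ≡⟨ *-identityʳ K ⟨
    K * 1ℚ        ≤⟨ *-mono-≤ˡ 0≤K 1≤Kε ⟩
    K * (K * ε)   ≡⟨ solve 2 (λ K ε → K :* (K :* ε) := ε :* (K :* K)) refl K ε ⟩
    ε * (K * K)   ∎
  θ≤ : θ ≤ 3ℚ * (s * ε) + η
  θ≤ = *-cancel-≤ˡ (*-pos 0<K 0<K) (begin
    K * K * θ                                              ≡⟨ *-comm (K * K) θ ⟩
    θ * (K * K)                                            ≤⟨ *-mono-≤ˡ 0≤θ K²≤ ⟩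
    θ * (s * (K + P))                                      ≡⟨ solve 4 (λ θ s K P → θ :* (s :* (K :+ P)) := θ :* (s :* K) :+ s :* (θ :* P)) refl θ s K P ⟩
    θ * (s * K) + s * (θ * P)                              ≤⟨ +-mono-≤ (*-mono-≤ʳ (*-nonneg 0≤s 0≤K) θ≤1) (*-mono-≤ˡ 0≤s (≤-trans θP≤ (*-mono-≤ˡ 0≤2 X≤))) ⟩
    1ℚ * (s * K) + s * (2ℚ * (2ℚ * E * i + ε * (K * K)))
      ≤⟨ +-monoˡ-≤ (s * (2ℚ * (2ℚ * E * i + ε * (K * K)))) (*-mono-≤ˡ 0≤1 (*-mono-≤ˡ 0≤s K≤εK²)) ⟩
    1ℚ * (s * (ε * (K * K))) + s * (2ℚ * (2ℚ * E * i + ε * (K * K)))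
      ≡⟨ solve 5 (λ s ε Q E i → con 1ℚ :* (s :* (ε :* Q)) :+ s :* (con 2ℚ :* (con 2ℚ :* E :* i :+ ε :* Q))
           := con 3ℚ :* (s :* ε) :* Q :+ E :* (con 2ℚ :* con 2ℚ :* s) :* i) refl s ε (K * K) E i ⟩
    3ℚ * (s * ε) * (K * K) + E * (2ℚ * 2ℚ * s) * i         ≤⟨ +-monoʳ-≤ (3ℚ * (s * ε) * (K * K)) edits ⟩
    3ℚ * (s * ε) * (K * K) + η * (K * K)                   ≡⟨ solve 3 (λ x η Q → x :* Q :+ η :* Q := Q :* (x :+ η)) refl (3ℚ * (s * ε)) η (K * K) ⟩
    K * K * (3ℚ * (s * ε) + η)                             ∎)
  δ≤ : δ ≤ 5ℚ * (s * ε)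
  δ≤ = ≤-trans (≤-by (3ℚ * (s * ε) + η - θ) (≤⇒0≤- θ≤)
    (solve 3 (λ s ε δ → con 2ℚ :* ε :+ con 3ℚ :* (s :* ε) := δ :+ (con 3ℚ :* (s :* ε) :+ (con 1ℚ :- con 3ℚ :* δ) :- (con 1ℚ :- con 2ℚ :* (ε :+ δ)))) refl s ε δ))
    2ε+3sε≤5sε

-- n ≤ 2 M L and n ≥ 2 M² Q² give n Q² ≤ 2 L², and 1 ≤ Q ε.
rows-bound : ∀ {ε ν μ Q ℓ} → 0ℚ ≤ ν → 0ℚ < μ → 1ℚ ≤ Q * ε → ν ≤ 2ℚ * (μ * ℓ) → 2ℚ * (μ * μ) * (Q * Q) ≤ ν →
  ν + ν ≤ 2ℚ * 2ℚ * (ε * ε * (ℓ * ℓ))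
rows-bound {ε} {ν} {μ} {Q} {ℓ} 0≤ν 0<μ 1≤Qε ν≤ ≤ν = begin
  ν + ν                             ≡⟨ solve 1 (λ ν → ν :+ ν := con 2ℚ :* (ν :* (con 1ℚ :* con 1ℚ))) refl ν ⟩
  2ℚ * (ν * (1ℚ * 1ℚ))              ≤⟨ *-mono-≤ˡ 0≤2 (*-mono-≤ˡ 0≤ν (square-mono (nonNegative⁻¹ 1ℚ) 1≤Qε)) ⟩
  2ℚ * (ν * (Q * ε * (Q * ε)))      ≡⟨ solve 3 (λ ν Q ε → con 2ℚ :* (ν :* (Q :* ε :* (Q :* ε))) := con 2ℚ :* (ε :* ε :* (ν :* (Q :* Q)))) refl ν Q ε ⟩
  2ℚ * (ε * ε * (ν * (Q * Q)))      ≤⟨ *-mono-≤ˡ 0≤2 (*-mono-≤ˡ (square-nonneg ε) νQ²≤) ⟩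
  2ℚ * (ε * ε * (2ℚ * (ℓ * ℓ)))     ≡⟨ solve 2 (λ ε ℓ → con 2ℚ :* (ε :* (con 2ℚ :* ℓ)) := con 2ℚ :* con 2ℚ :* (ε :* ℓ)) refl (ε * ε) (ℓ * ℓ) ⟩
  2ℚ * 2ℚ * (ε * ε * (ℓ * ℓ))       ∎
  where
  open ≤-Reasoning
  0≤2 : 0ℚ ≤ 2ℚ
  0≤2 = nonNegative⁻¹ 2ℚ
  νQ²≤ : ν * (Q * Q) ≤ 2ℚ * (ℓ * ℓ)
  νQ²≤ = *-cancel-≤ˡ (*-pos (positive⁻¹ 2ℚ) (*-pos 0<μ 0<μ)) (begin
    2ℚ * (μ * μ) * (ν * (Q * Q))    ≡⟨ solve 3 (λ a ν Q → a :* (ν :* Q) := a :* Q :* ν) refl (2ℚ * (μ * μ)) ν (Q * Q) ⟩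
    2ℚ * (μ * μ) * (Q * Q) * ν      ≤⟨ *-mono-≤ʳ 0≤ν ≤ν ⟩
    ν * ν                           ≤⟨ square-mono 0≤ν ν≤ ⟩
    2ℚ * (μ * ℓ) * (2ℚ * (μ * ℓ))   ≡⟨ solve 2 (λ μ ℓ → con 2ℚ :* (μ :* ℓ) :* (con 2ℚ :* (μ :* ℓ)) := con 2ℚ :* (μ :* μ) :* (con 2ℚ :* (ℓ :* ℓ))) refl μ ℓ ⟩
    2ℚ * (μ * μ) * (2ℚ * (ℓ * ℓ))   ∎)

-- Extracting a configuration

module _ {n k L} (H : Graph n) (δ : ℚ) (W : Cylinder n k L) where
  -- The clause i ≠ j makes every diagonal pair extreme, so that the clique found by `turan`
  -- consists of distinct sets.
  Middle : Fin k → Fin k → Set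
  Middle i j = ¬ (i ≡ j) × δ < density H (side W i) (side W j) × density H (side W i) (side W j) < 1ℚ - δ

  middle? : ∀ i j → Dec (Middle i j)
  middle? i j = ¬? (i Finₚ.≟ j) ×-dec (δ <? density H (side W i) (side W j)) ×-dec (density H (side W i) (side W j) <? 1ℚ - δ)

  extreme : Fin k → Fin k → Bool
  extreme i j = not (does (middle? i j))

  ¬extreme⇒middle : ∀ i j → extreme i j ≡ false → Middle i j
  ¬extreme⇒middle i j eq = holds (middle? i j) eq
    where
    holds : (d : Dec (Middle i j)) → not (does d) ≡ false → Middle i j
    holds (yes mid) _ = mid

  ¬middle⇒extreme : ∀ {i j} → ¬ (i ≡ j) → ¬ Middle i j →
    density H (side W i) (side W j) ≤ δ ⊎ 1ℚ - δ ≤ density H (side W i) (side W j)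
  ¬middle⇒extreme {i} {j} i≢j ¬mid with δ <? density H (side W i) (side W j)
  ... | no δ≮d = inj₁ (≮⇒≥ δ≮d)
  ... | yes δ<d = inj₂ (≮⇒≥ λ d<1-δ → ¬mid (i≢j , δ<d , d<1-δ))

  -- Turán's count runs over all ordered pairs including the diagonal, whose k entries are split off
  -- on the right.
  configuration-or-extreme : ∀ {ε} s → (∀ i j → ¬ (i ≡ j) → IsRegular ε H (side W i) (side W j)) →
    HasConfiguration H ε (suc s) L δ ⊎ ⟦ k ⟧ * ⟦ k ⟧ ≤ ⟦ s ⟧ * (⟦ k ⟧ + pairSum (λ i j → ind (extreme i j)))
  configuration-or-extreme {ε} s regular = convert (turan extreme s full)
    where
    open ≤-Reasoning
    w : Fin k → Fin k → ℚ
    w i j = ind (extreme i j)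
    0≤w : ∀ i j → 0ℚ ≤ w i j
    0≤w i j = ind-nonneg (extreme i j)
    convert : Clique extreme (suc s) full ⊎ ⟦ card (full {k}) ⟧ * ⟦ card (full {k}) ⟧ ≤ ⟦ s ⟧ * bil w full full →
      HasConfiguration H ε (suc s) L δ ⊎ ⟦ k ⟧ * ⟦ k ⟧ ≤ ⟦ s ⟧ * (⟦ k ⟧ + pairSum w)
    convert (inj₁ (f , _ , clique)) = inj₁ ((λ i → side W (f i)) , disj , (λ i → size W (f i)) ,
      λ i j i<j → let i≢j , δ<d , d<1-δ = mid i j i<j in regular (f i) (f j) i≢j , δ<d , d<1-δ)
      where
      mid : ∀ i j → i Fin.< j → Middle (f i) (f j)
      mid i j i<j = ¬extreme⇒middle (f i) (f j) (clique i j i<j)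
      disj : ∀ i j → ¬ (i ≡ j) → Disjoint (side W (f i)) (side W (f j))
      disj i j i≢j = disjoint W (f i) (f j) (distinct (Finₚ.<-cmp i j))
        where
        distinct : Tri (i Fin.< j) (i ≡ j) (j Fin.< i) → ¬ (f i ≡ f j)
        distinct (tri< i<j _ _) = proj₁ (mid i j i<j)
        distinct (tri≈ _ i≡j _) = contradiction i≡j i≢j
        distinct (tri> _ _ j<i) = proj₁ (mid j i j<i) ∘ sym
    convert (inj₂ many) = inj₂ (begin
      ⟦ k ⟧ * ⟦ k ⟧                          ≡⟨ cong (λ c → ⟦ c ⟧ * ⟦ c ⟧) (∣⊤∣≡n k) ⟨
      ⟦ card (full {k}) ⟧ * ⟦ card (full {k}) ⟧ ≤⟨ many ⟩
      ⟦ s ⟧ * bil w full full                ≤⟨ *-mono-≤ˡ (⟦⟧-nonneg s) total ⟩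
      ⟦ s ⟧ * (⟦ k ⟧ + pairSum w)            ∎)
      where
      total : bil w full full ≤ ⟦ k ⟧ + pairSum w
      total = begin
        bil w full full                  ≤⟨ ∑∈-mono full (λ {i} _ → ∑∈≤sum full (0≤w i)) ⟩
        ∑∈ full (λ i → sum (w i))        ≤⟨ ∑∈≤sum full (λ i → sum-nonneg (0≤w i)) ⟩
        sum₂ w                           ≡⟨ pairSum-diagonal w ⟩
        sum (λ i → w i i) + pairSum w    ≤⟨ +-monoˡ-≤ (pairSum w) (≤-trans (sum-mono λ i → ind≤1 (extreme i i))
                                              (≤-reflexive (trans (sum-const k 1ℚ) (*-identityʳ ⟦ k ⟧)))) ⟩
        ⟦ k ⟧ + pairSum w                ∎

extreme-cost : ∀ {n k L C ε δ} (S : SignMatrix n C) (H : Graph n) (W : Cylinder n k L) → 0ℚ < ε → 0 ℕ.< L →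
  C ≤ 2ℚ * 2ℚ * (ε * ε * (⟦ L ⟧ * ⟦ L ⟧)) →
  (1ℚ - 2ℚ * (ε + δ)) * pairSum (λ i j → ind (extreme H δ W i j))
    ≤ 2ℚ * pairSum (λ i j → bil (changed (quasirandom S) H) (side W i) (side W j) * inv L)
extreme-cost {k = k} {L} {ε = ε} {δ} S H W 0<ε 0<L C≤ = subst₂ _≤_ (pairSum-* θ (λ i j → ind (extreme H δ W i j))) (pairSum-* 2ℚ D)
  (pairSum-mono λ i j i≢j → cost i j i≢j (middle? H δ W i j))
  where
  θ = 1ℚ - 2ℚ * (ε + δ)
  D : Fin k → Fin k → ℚ
  D i j = bil (changed (quasirandom S) H) (side W i) (side W j) * inv L
  cost : ∀ i j → ¬ (i ≡ j) → (d : Dec (Middle H δ W i j)) → θ * ind (not (does d)) ≤ 2ℚ * D i j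
  cost i j _ (yes _) = subst (_≤ 2ℚ * D i j) (sym (*-zeroʳ θ))
    (*-nonneg (nonNegative⁻¹ 2ℚ) (normalised-nonneg {A = side W i} {side W j} 0<L (changed-nonneg (quasirandom S) H)))
  cost i j i≢j (no ¬mid) = subst (_≤ 2ℚ * D i j) (sym (*-identityʳ θ))
    (extreme-density-cost S H 0<ε 0<L (disjoint W i j i≢j) (size W i) (size W j) C≤ (¬middle⇒extreme H δ W i≢j ¬mid))

-- Choice of the parameters

scale-* : ∀ q m t → scale q m t ≡ scale q 1 t ℕ.* m
scale-* q m zero = sym (ℕ.*-identityˡ m)
scale-* q m (suc t) = trans (cong (suc q ℕ.*_) (scale-* q m t)) (sym (ℕ.*-assoc (suc q) (scale q 1 t) m))

-- Here s = r - 1 and M = k (q + 1)^T. One starts with k sets of size m (q + 1)^T, where m is the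
-- integer quotient of n by M; after at most T cuts the size L is still at least m, so L M misses n
-- by less than M ≤ ε n.
robust : ∀ {ε δ n k q T M s} → 0ℚ < ε → 1ℚ ≤ ⟦ suc q ⟧ * ε → 1ℚ ≤ ⟦ k ⟧ * ε →
  ⟦ suc q ⟧ * ⟦ suc q ⟧ * (⟦ k ⟧ * ⟦ k ⟧ + ε * (⟦ k ⟧ * ⟦ k ⟧)) < ⟦ T ⟧ * (ε * (ε * ε)) →
  0 ℕ.< k → 0 ℕ.< M → (∀ m → k ℕ.* scale q m T ≡ M ℕ.* m) → M ℕ.* k ℕ.≤ n → 2ℚ * (⟦ M ⟧ * ⟦ M ⟧) * (⟦ k ⟧ * ⟦ k ⟧) ≤ ⟦ n ⟧ →
  1 ℕ.≤ s → 0ℚ < δ → δ < 1ℚ → 5ℚ * (⟦ s ⟧ * ε) < δ →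
  (S : SignMatrix n ⟦ n ℕ.+ n ⟧) (H : Graph n) →
  ⟦ editDist (quasirandom S) H ⟧ * (2ℚ * 2ℚ * ⟦ s ⟧) < ⟦ n ⟧ * ⟦ n ⟧ * (1ℚ - 3ℚ * δ) * ((1ℚ - ε) * (1ℚ - ε)) →
  ∃[ L ] (⟦ n ⟧ * (1ℚ - ε) ≤ ⟦ L ⟧ * ⟦ M ⟧) × HasConfiguration H ε (suc s) L δ
robust {ε} {δ} {n} {k} {q} {T} {M} {s} 0<ε 1≤Qε 1≤Kε enough 0<k 0<M kscale Mk≤n N≤ν 1≤s 0<δ δ<1 small S H few =
  L , large , config (configuration-or-extreme H δ W s regular)
  where
  open ≤-Reasoning
  instance
    M≢0 : ℕ.NonZero M
    M≢0 = ℕ.>-nonZero 0<M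
    k≢0 : ℕ.NonZero k
    k≢0 = ℕ.>-nonZero 0<k
  K = ⟦ k ⟧
  μ = ⟦ M ⟧
  0≤ε = <⇒≤ 0<ε
  0<μ : 0ℚ < μ
  0<μ = subst (_< μ) ⟦⟧-0 (⟦⟧-< 0<M)
  0<K : 0ℚ < K
  0<K = subst (_< K) ⟦⟧-0 (⟦⟧-< 0<k)
  G = quasirandom S
  Δ = changed G H
  0≤Δ = changed-nonneg G H
  ν = ⟦ n ⟧
  m = n ℕ./ M
  L₀ = scale q m T
  0<m : 0 ℕ.< m
  0<m = m≥n⇒m/n>0 (ℕ.≤-trans (ℕ.m≤m*n M k) Mk≤n)
  kL₀≡Mm : k ℕ.* L₀ ≡ M ℕ.* m
  kL₀≡Mm = kscale m
  kL₀≤n : k ℕ.* L₀ ℕ.≤ n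
  kL₀≤n = subst (ℕ._≤ n) (trans (ℕ.*-comm m M) (sym kL₀≡Mm)) (m/n*n≤m n M)
  n≤M+Mm : n ℕ.≤ M ℕ.+ M ℕ.* m
  n≤M+Mm = subst₂ ℕ._≤_ (sym (m≡m%n+[m/n]*n n M)) (cong (M ℕ.+_) (ℕ.*-comm m M)) (ℕ.+-monoˡ-≤ (m ℕ.* M) (ℕ.<⇒≤ (m%n<n n M)))
  0<L₀ = ℕ.≤-trans 0<m (m≤scale q m T)
  μK≤ν : μ * K ≤ ν
  μK≤ν = subst (_≤ ν) (⟦⟧-* M k) (⟦⟧-≤ Mk≤n)
  μ≤εν : μ ≤ ε * ν
  μ≤εν = begin
    μ             ≡⟨ *-identityʳ μ ⟨
    μ * 1ℚ        ≤⟨ *-mono-≤ˡ (<⇒≤ 0<μ) 1≤Kε ⟩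
    μ * (K * ε)   ≡⟨ solve 3 (λ μ K ε → μ :* (K :* ε) := ε :* (μ :* K)) refl μ K ε ⟩
    ε * (μ * K)   ≤⟨ *-mono-≤ˡ 0≤ε μK≤ν ⟩
    ε * ν         ∎
  ν≤μ+Mm : ν ≤ μ + ⟦ M ℕ.* m ⟧
  ν≤μ+Mm = subst (ν ≤_) (⟦⟧-+ M (M ℕ.* m)) (⟦⟧-≤ n≤M+Mm)
  covered : (1ℚ - ε) * ν ≤ ⟦ M ℕ.* m ⟧
  covered = ≤-by (ε * ν - μ + (μ + ⟦ M ℕ.* m ⟧ - ν)) (+-nonneg (≤⇒0≤- μ≤εν) (≤⇒0≤- ν≤μ+Mm))
    (solve 4 (λ ε ν μ x → x := (con 1ℚ :- ε) :* ν :+ (ε :* ν :- μ :+ (μ :+ x :- ν))) refl ε ν μ ⟦ M ℕ.* m ⟧)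
  1≤σ : 1ℚ ≤ ⟦ s ⟧
  1≤σ = subst (_≤ ⟦ s ⟧) ⟦⟧-1 (⟦⟧-≤ 1≤s)
  ε≤1 : ε ≤ 1ℚ
  ε≤1 = ≤-trans (≤-by (5ℚ * ε * (⟦ s ⟧ - 1ℚ) + 2ℚ * 2ℚ * ε)
      (+-nonneg (*-nonneg (*-nonneg (nonNegative⁻¹ 5ℚ) 0≤ε) (≤⇒0≤- 1≤σ)) (*-nonneg (nonNegative⁻¹ (2ℚ * 2ℚ)) 0≤ε))
      (solve 2 (λ ε s → con 5ℚ :* (s :* ε) := ε :+ (con 5ℚ :* ε :* (s :- con 1ℚ) :+ con 2ℚ :* con 2ℚ :* ε)) refl ε ⟦ s ⟧))
    (<⇒≤ (<-trans small δ<1))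
  ground = subset-of-size (k ℕ.* L₀) (full {n}) (subst (k ℕ.* L₀ ℕ.≤_) (sym (∣⊤∣≡n n)) kL₀≤n)
  𝓑 : Blocks k L₀ (proj₁ ground)
  𝓑 = blocks k L₀ (proj₁ ground) (proj₂ (proj₂ ground))
  W₀ : Cylinder n k L₀
  W₀ = record { side = part 𝓑 ; size = size 𝓑 ; disjoint = disjoint 𝓑 }
  ∑Δ₀ = ∑Δ H ε Δ 0≤ε 0≤Δ W₀
  ∑Δ₀≤K² : ∑Δ₀ ≤ K * K
  ∑Δ₀≤K² = ≤-trans (pairSum-mono λ i j _ → normalised≤1 {A = part 𝓑 i} {part 𝓑 j} 0<L₀ (size 𝓑 i) (size 𝓑 j) (λ u v → ind≤1 (adj G u v xor adj H u v)))
    (pairSum≤square k)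
  fuel : ⟦ suc q ⟧ * ⟦ suc q ⟧ * (Φ H ε Δ W₀ + ε * (K * K)) < ⟦ T ⟧ * (ε * (ε * ε))
  fuel = ≤-<-trans (*-mono-≤ˡ (square-nonneg ⟦ suc q ⟧) (+-monoˡ-≤ (ε * (K * K)) (≤-trans (Φ≤∑Δ H ε Δ 0≤ε 0≤Δ W₀) ∑Δ₀≤K²))) enough
  final = regularise H ε Δ 0≤ε 0≤Δ {k} {q} {m} T 1≤Qε 0<m W₀ fuel
  L = proj₁ final
  m≤L = proj₁ (proj₂ final)
  W = proj₁ (proj₂ (proj₂ final))
  Φ≤Φ₀ = proj₁ (proj₂ (proj₂ (proj₂ final)))
  regular = proj₂ (proj₂ (proj₂ (proj₂ final)))
  0<L = ℕ.≤-trans 0<m m≤L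
  ℓ = ⟦ L ⟧
  Mm≤μℓ : ⟦ M ℕ.* m ⟧ ≤ μ * ℓ
  Mm≤μℓ = subst (⟦ M ℕ.* m ⟧ ≤_) (⟦⟧-* M L) (⟦⟧-≤ (ℕ.*-monoʳ-≤ M m≤L))
  large : ν * (1ℚ - ε) ≤ ℓ * μ
  large = subst₂ _≤_ (*-comm (1ℚ - ε) ν) (*-comm μ ℓ) (≤-trans covered Mm≤μℓ)
  -- As m ≥ 1, the remainder of n modulo M is at most M m, so n ≤ 2 M m.
  ν≤2μℓ : ν ≤ 2ℚ * (μ * ℓ)
  ν≤2μℓ = begin
    ν                     ≤⟨ ν≤μ+Mm ⟩
    μ + ⟦ M ℕ.* m ⟧       ≤⟨ +-mono-≤ (⟦⟧-≤ (ℕ.m≤m*n M m {{ℕ.>-nonZero 0<m}})) ≤-refl ⟩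
    ⟦ M ℕ.* m ⟧ + ⟦ M ℕ.* m ⟧ ≤⟨ +-mono-≤ Mm≤μℓ Mm≤μℓ ⟩
    μ * ℓ + μ * ℓ         ≡⟨ solve 1 (λ x → x :+ x := con 2ℚ :* x) refl (μ * ℓ) ⟩
    2ℚ * (μ * ℓ)          ∎
  C≤ : ⟦ n ℕ.+ n ⟧ ≤ 2ℚ * 2ℚ * (ε * ε * (ℓ * ℓ))
  C≤ = subst (_≤ 2ℚ * 2ℚ * (ε * ε * (ℓ * ℓ))) (sym (⟦⟧-+ n n)) (rows-bound {ε} {Q = K} (⟦⟧-nonneg n) 0<μ 1≤Kε ν≤2μℓ N≤ν)
  ∑Δ≤ : ∑Δ H ε Δ 0≤ε 0≤Δ W ≤ 2ℚ * ⟦ editDist G H ⟧ * inv L₀ + ε * (K * K)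
  ∑Δ≤ = begin
    ∑Δ H ε Δ 0≤ε 0≤Δ W             ≤⟨ ∑Δ≤Φ H ε Δ 0≤ε 0≤Δ 0<L W ⟩
    Φ H ε Δ W + ε * (K * K)        ≤⟨ +-monoˡ-≤ (ε * (K * K)) (≤-trans Φ≤Φ₀ (Φ≤∑Δ H ε Δ 0≤ε 0≤Δ W₀)) ⟩
    ∑Δ₀ + ε * (K * K)              ≤⟨ +-monoˡ-≤ (ε * (K * K)) initial ⟩
    2ℚ * ⟦ editDist G H ⟧ * inv L₀ + ε * (K * K) ∎
    where
    D : Fin k → Fin k → ℚ
    D i j = bil Δ (part 𝓑 i) (part 𝓑 j)
    initial : ∑Δ₀ ≤ 2ℚ * ⟦ editDist G H ⟧ * inv L₀
    initial = begin
      pairSum (λ i j → D i j * inv L₀)   ≤⟨ pairSum-mono (λ i j _ → ≤-reflexive (*-comm (D i j) (inv L₀))) ⟩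
      pairSum (λ i j → inv L₀ * D i j)   ≡⟨ pairSum-* (inv L₀) D ⟩
      inv L₀ * pairSum D                 ≤⟨ *-mono-≤ˡ (inv-nonneg 0<L₀) (blocks-edits G H 𝓑) ⟩
      inv L₀ * (2ℚ * ⟦ editDist G H ⟧)   ≡⟨ *-comm (inv L₀) (2ℚ * ⟦ editDist G H ⟧) ⟩
      2ℚ * ⟦ editDist G H ⟧ * inv L₀     ∎
  config : HasConfiguration H ε (suc s) L δ ⊎ K * K ≤ ⟦ s ⟧ * (K + pairSum (λ i j → ind (extreme H δ W i j))) →
    HasConfiguration H ε (suc s) L δ
  config (inj₁ found) = found
  -- Edits are counted at the initial size `L₀`, where the sets cover almost all vertices; the
  -- discrepancy of `G` is used at the final size `L`.
  config (inj₂ many) = ⊥-elim (edits-too-few {ν = ν} {ℓ = ⟦ L₀ ⟧} {i = inv L₀} 0<ε (<⇒≤ 0<δ) 1≤σ small 0<K 1≤Kε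
    (*-nonneg (≤⇒0≤- ε≤1) (⟦⟧-nonneg n)) (≤-trans covered (≤-reflexive (trans (cong ⟦_⟧ (sym kL₀≡Mm)) (⟦⟧-* k L₀))))
    (inv-nonneg 0<L₀) (inv-* 0<L₀) (⟦⟧-nonneg (editDist G H)) few ∑Δ≤
    (extreme-cost {δ = δ} S H W 0<ε 0<L C≤) many)

theorem2p6 : (ε : ℚ) → 0ℚ < ε →
    ∃[ M ] (0 <ℕ M) ×
      ((r : ℕ) → 2 ≤ℕ r → (δ : ℚ) → 0ℚ < δ → δ < 1ℚ →
        ε * ℕ→ℚ (16 *ℕ (r ∸ 1)) < δ →
        ∃[ N ] ((n : ℕ) → N ≤ℕ n →
          ∃[ G ] ((H : Graph n) →
            ℕ→ℚ (editDist G H) * ℕ→ℚ (4 *ℕ (r ∸ 1))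
              < ℕ→ℚ (n *ℕ n) * (1ℚ - (+ 3 / 1) * δ) * ((1ℚ - ε) * (1ℚ - ε)) →
            ∃[ L ] (ℕ→ℚ n * (1ℚ - ε) ≤ ℕ→ℚ L * ℕ→ℚ M) × HasConfiguration H ε r L δ)))
theorem2p6 ε 0<ε = M , 0<M , λ { (suc s) (ℕ.s≤s 1≤s) δ 0<δ δ<1 small → N , result s 1≤s δ 0<δ δ<1 small }
  where
  open ≤-Reasoning
  0≤ε = <⇒≤ 0<ε
  -- The number of sets and the number of blocks per cut are both the denominator of ε.
  q = proj₁ (denominator-bound 0<ε)
  1≤Kε = proj₂ (denominator-bound 0<ε)
  k = suc q
  K = ⟦ k ⟧
  -- The initial edit sum, hence the initial potential, is at most K²; adding ε K² makes it
  -- nonnegative, and every step removes ε³ from its K²-fold.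
  steps : ∃[ T ] K * K * (K * K + ε * (K * K)) < ⟦ T ⟧ * (ε * (ε * ε))
  steps = archimedean (*-nonneg (square-nonneg K) (+-nonneg (square-nonneg K) (*-nonneg 0≤ε (square-nonneg K))))
    (*-pos 0<ε (*-pos 0<ε 0<ε))
  T = proj₁ steps
  -- k^(T+1): one factor k for the number of sets, the others for the T cuts.
  M = scale q 1 (suc T)
  -- n ≥ M k keeps the uncovered vertices below ε n, and n ≥ 2 (M k)² makes the final sets large
  -- enough for the discrepancy bound.
  N = 2 ℕ.* (M ℕ.* k ℕ.* (M ℕ.* k))
  0<M : 0 ℕ.< M
  0<M = m≤scale q 1 (suc T)
  0<Mk : 0 ℕ.< M ℕ.* k
  0<Mk = ℕ.*-mono-≤ 0<M (ℕ.z<s {q})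
  Mk≤N : M ℕ.* k ℕ.≤ N
  Mk≤N = ℕ.≤-trans (ℕ.m≤m*n (M ℕ.* k) (M ℕ.* k) {{ℕ.>-nonZero 0<Mk}}) (ℕ.m≤m+n _ _)
  N≤⇒ : ∀ {n} → N ℕ.≤ n → 2ℚ * (⟦ M ⟧ * ⟦ M ⟧) * (K * K) ≤ ⟦ n ⟧
  N≤⇒ {n} N≤n = begin
    2ℚ * (⟦ M ⟧ * ⟦ M ⟧) * (K * K)       ≡⟨ solve 2 (λ μ K → con 2ℚ :* (μ :* μ) :* (K :* K) := con 2ℚ :* (μ :* K :* (μ :* K))) refl ⟦ M ⟧ K ⟩
    2ℚ * (⟦ M ⟧ * K * (⟦ M ⟧ * K))       ≡⟨ cong₂ _*_ (⟦⟧-def 2) (cong₂ _*_ (⟦⟧-* M k) (⟦⟧-* M k)) ⟨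
    ⟦ 2 ⟧ * (⟦ M ℕ.* k ⟧ * ⟦ M ℕ.* k ⟧)  ≡⟨ cong (⟦ 2 ⟧ *_) (⟦⟧-* (M ℕ.* k) (M ℕ.* k)) ⟨
    ⟦ 2 ⟧ * ⟦ M ℕ.* k ℕ.* (M ℕ.* k) ⟧    ≡⟨ ⟦⟧-* 2 (M ℕ.* k ℕ.* (M ℕ.* k)) ⟨
    ⟦ N ⟧                                ≤⟨ ⟦⟧-≤ N≤n ⟩
    ⟦ n ⟧                                ∎
  result : ∀ s → 1 ℕ.≤ s → ∀ δ → 0ℚ < δ → δ < 1ℚ → ε * ℕ→ℚ (16 ℕ.* s) < δ → ∀ n → N ℕ.≤ n →
    ∃[ G ] ((H : Graph n) →
      ℕ→ℚ (editDist G H) * ℕ→ℚ (4 ℕ.* s) < ℕ→ℚ (n ℕ.* n) * (1ℚ - 3ℚ * δ) * ((1ℚ - ε) * (1ℚ - ε)) →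
      ∃[ L ] (ℕ→ℚ n * (1ℚ - ε) ≤ ℕ→ℚ L * ℕ→ℚ M) × HasConfiguration H ε (suc s) L δ)
  result s 1≤s δ 0<δ δ<1 small zero N≤0 = contradiction (ℕ.≤-trans 0<Mk (ℕ.≤-trans Mk≤N N≤0)) λ ()
  result s 1≤s δ 0<δ δ<1 small n@(suc n-1) N≤n = quasirandom S , λ H few →
    let L , large , config = robust 0<ε 1≤Kε 1≤Kε (proj₂ steps) ℕ.z<s 0<M (λ m → scale-* q m (suc T)) (ℕ.≤-trans Mk≤N N≤n) (N≤⇒ N≤n)
                               1≤s 0<δ δ<1 small′ S H (few′ H few)
    in L , subst₂ _≤_ (cong (_* (1ℚ - ε)) (⟦⟧-def n)) (cong₂ _*_ (⟦⟧-def L) (⟦⟧-def M)) large , config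
    where
    S = sign-matrix n-1
    small′ : 5ℚ * (⟦ s ⟧ * ε) < δ
    small′ = begin-strict
      5ℚ * (⟦ s ⟧ * ε)          ≡⟨ solve 3 (λ c s ε → c :* (s :* ε) := ε :* (c :* s)) refl 5ℚ ⟦ s ⟧ ε ⟩
      ε * (5ℚ * ⟦ s ⟧)          ≡⟨ cong (λ c → ε * (c * ⟦ s ⟧)) (⟦⟧-def 5) ⟨
      ε * (⟦ 5 ⟧ * ⟦ s ⟧)       ≡⟨ cong (ε *_) (⟦⟧-* 5 s) ⟨
      ε * ⟦ 5 ℕ.* s ⟧           ≤⟨ *-mono-≤ˡ 0≤ε (⟦⟧-≤ (ℕ.*-monoˡ-≤ s (ℕ.m≤m+n 5 11))) ⟩
      ε * ⟦ 16 ℕ.* s ⟧          ≡⟨ cong (ε *_) (⟦⟧-def (16 ℕ.* s)) ⟩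
      ε * ℕ→ℚ (16 ℕ.* s)        <⟨ small ⟩
      δ                         ∎
    few′ : ∀ H → ℕ→ℚ (editDist (quasirandom S) H) * ℕ→ℚ (4 ℕ.* s) < ℕ→ℚ (n ℕ.* n) * (1ℚ - 3ℚ * δ) * ((1ℚ - ε) * (1ℚ - ε)) →
      ⟦ editDist (quasirandom S) H ⟧ * (2ℚ * 2ℚ * ⟦ s ⟧) < ⟦ n ⟧ * ⟦ n ⟧ * (1ℚ - 3ℚ * δ) * ((1ℚ - ε) * (1ℚ - ε))
    few′ H = subst₂ _<_
      (cong₂ _*_ (sym (⟦⟧-def (editDist (quasirandom S) H)))
        (trans (sym (⟦⟧-def (4 ℕ.* s))) (trans (⟦⟧-* 4 s) (cong (_* ⟦ s ⟧) (⟦⟧-def 4)))))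
      (cong (λ z → z * (1ℚ - 3ℚ * δ) * ((1ℚ - ε) * (1ℚ - ε))) (trans (sym (⟦⟧-def (n ℕ.* n))) (⟦⟧-* n n)))
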